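{- Let $a\ge 0$ be an integer. Suppose that all of the numbers $$\frac{\zeta(2a+3)}{\pi^{2a+3}},\ \frac{\zeta(2a+5)}{\pi^{2a+5}},\ \ldots,\ \frac{\zeta(4a+3)}{\pi^{4a+3}}$$ (that is, $\zeta(2k+1)/\pi^{2k+1}$ for $a+1\le k\le 2a+1$) are rational, and let $q_a$ denote their common denominator. Then $q_a\ge (2a+2)!$.
   Context: Here $\zeta$ is the Riemann zeta function. The common denominator of finitely many rational numbers is the least positive integer $q$ such that $q$ times each of them is an integer. -}

module Defs where

open import Data.Fin.Base using (Fin)
open import Data.Integer.Base as ℤ using (ℤ; +_)
import Data.Integer.Properties as ℤ
open import Data.Nat.Base as ℕ using (ℕ; zero; suc; NonTrivial; nonTrivial⇒n>1)
import Data.Nat.Properties as ℕ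
open import Data.Nat.Tactic.RingSolver using (solve-∀)
open import Data.Product.Base using (Σ-syntax; ∃-syntax; _×_; _,_; proj₁; proj₂)
open import Data.Rational.Base as ℚ using (ℚ; 0ℚ; 1ℚ; ∣_∣; *<*)
import Data.Rational.Properties as ℚ
open import Data.Rational.Solver using (module +-*-Solver)
import Data.Rational.Unnormalised.Base as ℚᵘ
import Data.Rational.Unnormalised.Properties as ℚᵘ
open import Data.Sum.Base using ([_,_]′)
open import Relation.Binary.PropositionalEquality
open import Relation.Nullary.Decidable using (yes; no; toWitness)
open import Relation.Nullary.Negation using (contradiction)

private

  *-mono-≤ : ∀ {p q r s} → 0ℚ ℚ.≤ p → 0ℚ ℚ.≤ s → p ℚ.≤ q → r ℚ.≤ s → p ℚ.* r ℚ.≤ q ℚ.* s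
  *-mono-≤ {p} {q} {r} {s} 0≤p 0≤s p≤q r≤s = ℚ.≤-trans
    (ℚ.*-monoˡ-≤-nonNeg p {{ℚ.nonNegative 0≤p}} r≤s)
    (ℚ.*-monoʳ-≤-nonNeg s {{ℚ.nonNegative 0≤s}} p≤q)

  *-pos : ∀ {p q} → 0ℚ ℚ.< p → 0ℚ ℚ.< q → 0ℚ ℚ.< p ℚ.* q
  *-pos {p} {q} 0<p 0<q = ℚ.positive⁻¹ (p ℚ.* q)
    {{ℚ.pos*pos⇒pos p {{ℚ.positive 0<p}} q {{ℚ.positive 0<q}}}}

  p-q≤r : ∀ {p q r} → p ℚ.≤ q ℚ.+ r → p ℚ.- q ℚ.≤ r
  p-q≤r {p} {q} {r} h = subst (p ℚ.- q ℚ.≤_) (lem q r) (ℚ.+-monoˡ-≤ (ℚ.- q) h)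
    where
    lem : ∀ q r → (q ℚ.+ r) ℚ.- q ≡ r
    lem = solve 2 (λ q r → (q :+ r) :- q := r) refl
      where open +-*-Solver

  0≤p-q : ∀ {p q} → q ℚ.≤ p → 0ℚ ℚ.≤ p ℚ.- q
  0≤p-q {p} {q} h = subst (ℚ._≤ p ℚ.- q) (ℚ.+-inverseʳ q) (ℚ.+-monoˡ-≤ (ℚ.- q) h)

  dist-sym : ∀ p q → ∣ p ℚ.- q ∣ ≡ ∣ q ℚ.- p ∣
  dist-sym p q = trans (cong ∣_∣ (lem p q)) (ℚ.∣-p∣≡∣p∣ (q ℚ.- p))
    where
    lem : ∀ p q → p ℚ.- q ≡ ℚ.- (q ℚ.- p)
    lem = solve 2 (λ p q → p :- q := :- (q :- p)) refl
      where open +-*-Solver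

  ≤-by : ∀ {m k n} → m ℕ.+ k ≡ n → m ℕ.≤ n
  ≤-by {m} {k} eq = subst (m ℕ.≤_) eq (ℕ.m≤m+n m k)

  cross : ∀ a b c d e f g h
          .{{_ : ℕ.NonZero b}} .{{_ : ℕ.NonZero d}} .{{_ : ℕ.NonZero f}} .{{_ : ℕ.NonZero h}} →
          (a ℕ.* d ℕ.+ c ℕ.* b) ℕ.* (f ℕ.* h) ℕ.≤ (e ℕ.* h ℕ.+ g ℕ.* f) ℕ.* (b ℕ.* d) →
          (+ a ℚ./ b) ℚ.+ (+ c ℚ./ d) ℚ.≤ (+ e ℚ./ f) ℚ.+ (+ g ℚ./ h)
  cross a (suc b) c (suc d) e (suc f) g (suc h) le = ℚ.toℚᵘ-cancel-≤
    (ℚᵘ.≤-respˡ-≃ (ℚᵘ.≃-sym (sum a b c d))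
      (ℚᵘ.≤-respʳ-≃ (ℚᵘ.≃-sym (sum e f g h))
        (ℚᵘ.*≤* (subst₂ ℤ._≤_ (clear a b c d f h) (clear e f g h b d) (ℤ.+≤+ le)))))
    where
    sum : ∀ a b c d → ℚ.toℚᵘ ((+ a ℚ./ suc b) ℚ.+ (+ c ℚ./ suc d))
                      ℚᵘ.≃ ℚᵘ.mkℚᵘ (+ a) b ℚᵘ.+ ℚᵘ.mkℚᵘ (+ c) d
    sum a b c d = ℚᵘ.≃-trans (ℚ.toℚᵘ-homo-+ (+ a ℚ./ suc b) (+ c ℚ./ suc d))
      (ℚᵘ.+-cong (ℚ.toℚᵘ-fromℚᵘ (ℚᵘ.mkℚᵘ (+ a) b)) (ℚ.toℚᵘ-fromℚᵘ (ℚᵘ.mkℚᵘ (+ c) d)))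
    clear : ∀ a b c d f h →
      + ((a ℕ.* suc d ℕ.+ c ℕ.* suc b) ℕ.* (suc f ℕ.* suc h)) ≡
      (+ a ℤ.* + suc d ℤ.+ + c ℤ.* + suc b) ℤ.* (+ (suc f ℕ.* suc h))
    clear a b c d f h = trans (ℤ.pos-* (a ℕ.* suc d ℕ.+ c ℕ.* suc b) (suc f ℕ.* suc h))
      (cong (ℤ._* (+ (suc f ℕ.* suc h)))
        (trans (ℤ.pos-+ (a ℕ.* suc d) (c ℕ.* suc b))
          (cong₂ ℤ._+_ (ℤ.pos-* a (suc d)) (ℤ.pos-* c (suc b)))))

  frac-≤ : ∀ a b c d .{{_ : ℕ.NonZero b}} .{{_ : ℕ.NonZero d}} →
           a ℕ.* d ℕ.≤ c ℕ.* b → (+ a ℚ./ b) ℚ.≤ (+ c ℚ./ d)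
  frac-≤ a b c d le = subst₂ ℚ._≤_ (ℚ.+-identityʳ _) (ℚ.+-identityʳ _)
    (cross a b 0 1 c d 0 1 (subst₂ ℕ._≤_ (lem a d) (lem c b) le))
    where
    lem : ∀ a d → a ℕ.* d ≡ (a ℕ.* 1 ℕ.+ 0) ℕ.* (d ℕ.* 1)
    lem = solve-∀

-- Real numbers are Cauchy sequences of rationals, with _≃_ as their equality.

IsCauchy : (ℕ → ℚ) → Set
IsCauchy x = ∀ ε → 0ℚ ℚ.< ε →
  ∃[ N ] (∀ m n → N ℕ.≤ m → N ℕ.≤ n → ∣ x m ℚ.- x n ∣ ℚ.≤ ε)

record ℝ : Set where
  constructor mkℝ
  field
    seq    : ℕ → ℚ
    cauchy : IsCauchy seq

open ℝ public

infix 4 _≃_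

_≃_ : ℝ → ℝ → Set
x ≃ y = ∀ ε → 0ℚ ℚ.< ε → ∃[ N ] (∀ n → N ℕ.≤ n → ∣ seq x n ℚ.- seq y n ∣ ℚ.≤ ε)

fromℚ : ℚ → ℝ
fromℚ p = mkℝ (λ _ → p) λ ε 0<ε →
  0 , λ _ _ _ _ → subst (ℚ._≤ ε) (cong ∣_∣ (sym (ℚ.+-inverseʳ p))) (ℚ.<⇒≤ 0<ε)

private
  bounded : ∀ {x} → IsCauchy x →
    ∃[ B ] (0ℚ ℚ.< B × ∃[ N ] (∀ n → N ℕ.≤ n → ∣ x n ∣ ℚ.≤ B))
  bounded {x} c = let N , close = c 1ℚ (toWitness {a? = 0ℚ ℚ.<? 1ℚ} _) in
        1ℚ ℚ.+ ∣ x N ∣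
      , ℚ.+-mono-<-≤ (toWitness {a? = 0ℚ ℚ.<? 1ℚ} _) (ℚ.0≤∣p∣ (x N))
      , N
      , λ n N≤n → ℚ.≤-trans (ℚ.≤-reflexive (cong ∣_∣ (lem (x n) (x N))))
          (ℚ.≤-trans (ℚ.∣p+q∣≤∣p∣+∣q∣ (x n ℚ.- x N) (x N))
            (ℚ.+-monoˡ-≤ ∣ x N ∣ (close n N N≤n ℕ.≤-refl)))
    where
    lem : ∀ p q → p ≡ (p ℚ.- q) ℚ.+ q
    lem = solve 2 (λ p q → p := (p :- q) :+ q) refl
      where open +-*-Solver

  *-close : ∀ {A B δ} p q r s → 0ℚ ℚ.≤ δ → ∣ p ∣ ℚ.≤ A → ∣ s ∣ ℚ.≤ B →
            ∣ q ℚ.- s ∣ ℚ.≤ δ → ∣ p ℚ.- r ∣ ℚ.≤ δ →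
            ∣ p ℚ.* q ℚ.- r ℚ.* s ∣ ℚ.≤ A ℚ.* δ ℚ.+ B ℚ.* δ
  *-close {A} {B} {δ} p q r s 0≤δ p≤A s≤B qs pr = subst (ℚ._≤ A ℚ.* δ ℚ.+ B ℚ.* δ)
    (sym (cong ∣_∣ (split p q r s)))
    (ℚ.≤-trans (ℚ.∣p+q∣≤∣p∣+∣q∣ (p ℚ.* (q ℚ.- s)) (s ℚ.* (p ℚ.- r)))
      (ℚ.+-mono-≤ (bound p (q ℚ.- s) p≤A qs) (bound s (p ℚ.- r) s≤B pr)))
    where
    split : ∀ p q r s → p ℚ.* q ℚ.- r ℚ.* s ≡ p ℚ.* (q ℚ.- s) ℚ.+ s ℚ.* (p ℚ.- r)
    split = solve 4 (λ p q r s → p :* q :- r :* s := p :* (q :- s) :+ s :* (p :- r)) refl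
      where open +-*-Solver
    bound : ∀ u v {C} → ∣ u ∣ ℚ.≤ C → ∣ v ∣ ℚ.≤ δ → ∣ u ℚ.* v ∣ ℚ.≤ C ℚ.* δ
    bound u v {C} u≤C v≤δ = subst (ℚ._≤ C ℚ.* δ) (sym (ℚ.∣p*q∣≡∣p∣*∣q∣ u v))
      (*-mono-≤ (ℚ.0≤∣p∣ u) 0≤δ u≤C v≤δ)

  split-ε : ∀ {A B ε} → 0ℚ ℚ.< A → 0ℚ ℚ.< B → 0ℚ ℚ.< ε →
            ∃[ δ ] (0ℚ ℚ.< δ × A ℚ.* δ ℚ.+ B ℚ.* δ ≡ ε)
  split-ε {A} {B} {ε} 0<A 0<B 0<ε =
    ε ℚ.* i , *-pos 0<ε (ℚ.positive⁻¹ i {{ℚ.1/pos⇒pos (A ℚ.+ B) {{ℚ.positive 0<A+B}}}}) , total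
    where
    0<A+B : 0ℚ ℚ.< A ℚ.+ B
    0<A+B = ℚ.+-mono-< 0<A 0<B
    A+B≢0 : ℚ.NonZero (A ℚ.+ B)
    A+B≢0 = ℚ.pos⇒nonZero (A ℚ.+ B) {{ℚ.positive 0<A+B}}
    i : ℚ
    i = (ℚ.1/ (A ℚ.+ B)) {{A+B≢0}}
    lem : ∀ a b e i → a ℚ.* (e ℚ.* i) ℚ.+ b ℚ.* (e ℚ.* i) ≡ e ℚ.* ((a ℚ.+ b) ℚ.* i)
    lem = solve 4 (λ a b e i → a :* (e :* i) :+ b :* (e :* i) := e :* ((a :+ b) :* i)) refl
      where open +-*-Solver
    total : A ℚ.* (ε ℚ.* i) ℚ.+ B ℚ.* (ε ℚ.* i) ≡ ε
    total = trans (lem A B ε i)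
      (trans (cong (ε ℚ.*_) (ℚ.*-inverseʳ (A ℚ.+ B) {{A+B≢0}})) (ℚ.*-identityʳ ε))

  *-cauchy : ∀ {x y} → IsCauchy x → IsCauchy y → IsCauchy (λ n → x n ℚ.* y n)
  *-cauchy {x} {y} cx cy ε 0<ε =
    let A , 0<A , Na , ≤A = bounded {x} cx
        B , 0<B , Nb , ≤B = bounded {y} cy
        δ , 0<δ , total   = split-ε 0<A 0<B 0<ε
        Nx , closex       = cx δ 0<δ
        Ny , closey       = cy δ 0<δ
    in (Na ℕ.⊔ Nb) ℕ.⊔ (Nx ℕ.⊔ Ny) , λ m n hm hn →
      subst (∣ x m ℚ.* y m ℚ.- x n ℚ.* y n ∣ ℚ.≤_) total
        (*-close (x m) (y m) (x n) (y n) (ℚ.<⇒≤ 0<δ)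
          (≤A m (ℕ.m⊔n≤o⇒m≤o Na Nb (ℕ.m⊔n≤o⇒m≤o (Na ℕ.⊔ Nb) (Nx ℕ.⊔ Ny) hm)))
          (≤B n (ℕ.m⊔n≤o⇒n≤o Na Nb (ℕ.m⊔n≤o⇒m≤o (Na ℕ.⊔ Nb) (Nx ℕ.⊔ Ny) hn)))
          (closey m n (ℕ.m⊔n≤o⇒n≤o Nx Ny (ℕ.m⊔n≤o⇒n≤o (Na ℕ.⊔ Nb) (Nx ℕ.⊔ Ny) hm))
                      (ℕ.m⊔n≤o⇒n≤o Nx Ny (ℕ.m⊔n≤o⇒n≤o (Na ℕ.⊔ Nb) (Nx ℕ.⊔ Ny) hn)))
          (closex m n (ℕ.m⊔n≤o⇒m≤o Nx Ny (ℕ.m⊔n≤o⇒n≤o (Na ℕ.⊔ Nb) (Nx ℕ.⊔ Ny) hm))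
                      (ℕ.m⊔n≤o⇒m≤o Nx Ny (ℕ.m⊔n≤o⇒n≤o (Na ℕ.⊔ Nb) (Nx ℕ.⊔ Ny) hn))))

infixl 7 _*_
infixr 8 _^_

_*_ : ℝ → ℝ → ℝ
x * y = mkℝ (λ n → seq x n ℚ.* seq y n) (*-cauchy {seq x} {seq y} (cauchy x) (cauchy y))

_^_ : ℝ → ℕ → ℝ
x ^ zero  = fromℚ 1ℚ
x ^ suc n = x * x ^ n

-- Apartness from zero, the constructive form of x ≠ 0.
_#0 : ℝ → Set
x #0 = ∃[ ε ] (0ℚ ℚ.< ε × ∃[ N ] (∀ n → N ℕ.≤ n → ε ℚ.≤ ∣ seq x n ∣))

*-#0 : ∀ {x y} → x #0 → y #0 → (x * y) #0
*-#0 {x} {y} (e , 0<e , M , ≤x) (f , 0<f , N , ≤y) =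
  e ℚ.* f , *-pos 0<e 0<f , M ℕ.⊔ N , λ n h →
    subst (e ℚ.* f ℚ.≤_) (sym (ℚ.∣p*q∣≡∣p∣*∣q∣ (seq x n) (seq y n)))
      (*-mono-≤ (ℚ.<⇒≤ 0<e) (ℚ.0≤∣p∣ (seq y n))
        (≤x n (ℕ.≤-trans (ℕ.m≤m⊔n M N) h)) (≤y n (ℕ.≤-trans (ℕ.m≤n⊔m M N) h)))

^-#0 : ∀ {x} n → x #0 → (x ^ n) #0
^-#0 zero    _ = 1ℚ , toWitness {a? = 0ℚ ℚ.<? 1ℚ} _ , 0 , λ _ _ → ℚ.≤-refl
^-#0 {x} (suc n) h = *-#0 {x} {x ^ n} h (^-#0 {x} n h)

-- The inverse on ℚ made total by 0 ↦ 0.  A sequence apart from zero may still have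
-- finitely many zero terms; their value does not affect the limit.
inv : ℚ → ℚ
inv p with p ℚ.≟ 0ℚ
... | yes _  = 0ℚ
... | no p≢0 = (ℚ.1/ p) {{ℚ.≢-nonZero p≢0}}

private
  abs≥⇒≢0 : ∀ {e p} → 0ℚ ℚ.< e → e ℚ.≤ ∣ p ∣ → p ≢ 0ℚ
  abs≥⇒≢0 0<e e≤p refl = ℚ.<-irrefl refl (ℚ.<-≤-trans 0<e e≤p)

  inv-inverse : ∀ {p} → p ≢ 0ℚ → p ℚ.* inv p ≡ 1ℚ
  inv-inverse {p} p≢0 with p ℚ.≟ 0ℚ
  ... | yes p≡0 = contradiction p≡0 p≢0
  ... | no  p≢0 = ℚ.*-inverseʳ p {{ℚ.≢-nonZero p≢0}}

  e*∣inv∣≤1 : ∀ {e p} → 0ℚ ℚ.< e → e ℚ.≤ ∣ p ∣ → e ℚ.* ∣ inv p ∣ ℚ.≤ 1ℚ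
  e*∣inv∣≤1 {e} {p} 0<e e≤p = ℚ.≤-trans
    (*-mono-≤ (ℚ.<⇒≤ 0<e) (ℚ.0≤∣p∣ (inv p)) e≤p ℚ.≤-refl)
    (ℚ.≤-reflexive (trans (sym (ℚ.∣p*q∣≡∣p∣*∣q∣ p (inv p)))
      (cong ∣_∣ (inv-inverse (abs≥⇒≢0 0<e e≤p)))))

  inv-cauchy : ∀ x → x #0 → IsCauchy (λ n → inv (seq x n))
  inv-cauchy x (e , 0<e , M , ≤x) ε 0<ε =
    let N , close = cauchy x (ε ℚ.* (e ℚ.* e)) (*-pos 0<ε (*-pos 0<e 0<e)) in
    M ℕ.⊔ N , λ m n hm hn →
      bound (≤x m (ℕ.≤-trans (ℕ.m≤m⊔n M N) hm)) (≤x n (ℕ.≤-trans (ℕ.m≤m⊔n M N) hn))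
        (close m n (ℕ.≤-trans (ℕ.m≤n⊔m M N) hm) (ℕ.≤-trans (ℕ.m≤n⊔m M N) hn))
    where
    diff : ∀ p q i j → p ℚ.* i ≡ 1ℚ → q ℚ.* j ≡ 1ℚ → i ℚ.- j ≡ (i ℚ.* j) ℚ.* (q ℚ.- p)
    diff p q i j pi≡1 qj≡1 = begin
      i ℚ.- j                                   ≡⟨ cong₂ ℚ._-_ (sym (ℚ.*-identityʳ i)) (sym (ℚ.*-identityʳ j)) ⟩
      i ℚ.* 1ℚ ℚ.- j ℚ.* 1ℚ                     ≡⟨ cong₂ (λ u v → i ℚ.* u ℚ.- j ℚ.* v) (sym qj≡1) (sym pi≡1) ⟩
      i ℚ.* (q ℚ.* j) ℚ.- j ℚ.* (p ℚ.* i)       ≡⟨ lem p q i j ⟩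
      (i ℚ.* j) ℚ.* (q ℚ.- p)                   ∎
      where
      open ≡-Reasoning
      lem : ∀ p q i j → i ℚ.* (q ℚ.* j) ℚ.- j ℚ.* (p ℚ.* i) ≡ (i ℚ.* j) ℚ.* (q ℚ.- p)
      lem = solve 4 (λ p q i j → i :* (q :* j) :- j :* (p :* i) := (i :* j) :* (q :- p)) refl
        where open +-*-Solver
    bound : ∀ {p q} → e ℚ.≤ ∣ p ∣ → e ℚ.≤ ∣ q ∣ → ∣ p ℚ.- q ∣ ℚ.≤ ε ℚ.* (e ℚ.* e) →
            ∣ inv p ℚ.- inv q ∣ ℚ.≤ ε
    bound {p} {q} e≤p e≤q d = begin
      ∣ i ℚ.- j ∣
        ≡⟨ cong ∣_∣ (diff p q i j (inv-inverse (abs≥⇒≢0 0<e e≤p)) (inv-inverse (abs≥⇒≢0 0<e e≤q))) ⟩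
      ∣ (i ℚ.* j) ℚ.* (q ℚ.- p) ∣
        ≡⟨ ℚ.∣p*q∣≡∣p∣*∣q∣ (i ℚ.* j) (q ℚ.- p) ⟩
      ∣ i ℚ.* j ∣ ℚ.* ∣ q ℚ.- p ∣
        ≡⟨ cong₂ ℚ._*_ (ℚ.∣p*q∣≡∣p∣*∣q∣ i j) (dist-sym q p) ⟩
      (∣ i ∣ ℚ.* ∣ j ∣) ℚ.* ∣ p ℚ.- q ∣
        ≤⟨ ℚ.*-monoˡ-≤-nonNeg (∣ i ∣ ℚ.* ∣ j ∣) {{ℚ.nonNegative 0≤ij}} d ⟩
      (∣ i ∣ ℚ.* ∣ j ∣) ℚ.* (ε ℚ.* (e ℚ.* e))
        ≡⟨ lem ∣ i ∣ ∣ j ∣ ε e ⟩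
      ε ℚ.* ((e ℚ.* ∣ i ∣) ℚ.* (e ℚ.* ∣ j ∣))
        ≤⟨ ℚ.*-monoˡ-≤-nonNeg ε {{ℚ.nonNegative (ℚ.<⇒≤ 0<ε)}}
             (*-mono-≤ {q = 1ℚ} {s = 1ℚ} (nn i) (toWitness {a? = 0ℚ ℚ.≤? 1ℚ} _)
               (e*∣inv∣≤1 0<e e≤p) (e*∣inv∣≤1 0<e e≤q)) ⟩
      ε ℚ.* (1ℚ ℚ.* 1ℚ)
        ≡⟨ ℚ.*-identityʳ ε ⟩
      ε ∎
      where
      open ℚ.≤-Reasoning
      i j : ℚ
      i = inv p
      j = inv q
      nn : ∀ r → 0ℚ ℚ.≤ e ℚ.* ∣ r ∣
      nn r = *-mono-≤ {r = 0ℚ} ℚ.≤-refl (ℚ.0≤∣p∣ r) (ℚ.<⇒≤ 0<e) (ℚ.0≤∣p∣ r)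
      0≤ij : 0ℚ ℚ.≤ ∣ i ∣ ℚ.* ∣ j ∣
      0≤ij = *-mono-≤ {r = 0ℚ} ℚ.≤-refl (ℚ.0≤∣p∣ j) (ℚ.0≤∣p∣ i) (ℚ.0≤∣p∣ j)
      lem : ∀ i j ε e → (i ℚ.* j) ℚ.* (ε ℚ.* (e ℚ.* e)) ≡ ε ℚ.* ((e ℚ.* i) ℚ.* (e ℚ.* j))
      lem = solve 4 (λ i j ε e → (i :* j) :* (ε :* (e :* e)) := ε :* ((e :* i) :* (e :* j))) refl
        where open +-*-Solver

infixl 7 _÷_[_]

_÷_[_] : (x y : ℝ) → y #0 → ℝ
x ÷ y [ y#0 ] = x * mkℝ (λ n → inv (seq y n)) (inv-cauchy y y#0)

partialSum : (ℕ → ℚ) → ℕ → ℚ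
partialSum f zero    = 0ℚ
partialSum f (suc n) = partialSum f n ℚ.+ f n

private
  module Series (f : ℕ → ℚ) (0≤f : ∀ n → 0ℚ ℚ.≤ f n) where

    S : ℕ → ℚ
    S = partialSum f

    S-mono : ∀ {m n} → m ℕ.≤′ n → S m ℚ.≤ S n
    S-mono ℕ.≤′-refl = ℚ.≤-refl
    S-mono (ℕ.≤′-step {n} h) = ℚ.≤-trans (S-mono h)
      (subst (ℚ._≤ S n ℚ.+ f n) (ℚ.+-identityʳ (S n)) (ℚ.+-monoʳ-≤ (S n) (0≤f n)))

    -- Comparison with the telescoping series Σ (c/(n+1) − c/(n+2)).
    module _ (c : ℕ) (f≤ : ∀ n → f n ℚ.+ (+ c ℚ./ suc (suc n)) ℚ.≤ (+ c ℚ./ suc n)) where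

      tail : ∀ {m n} → m ℕ.≤′ n → S n ℚ.+ (+ c ℚ./ suc n) ℚ.≤ S m ℚ.+ (+ c ℚ./ suc m)
      tail ℕ.≤′-refl = ℚ.≤-refl
      tail (ℕ.≤′-step {n} h) = ℚ.≤-trans
        (ℚ.≤-trans (ℚ.≤-reflexive (ℚ.+-assoc (S n) (f n) _)) (ℚ.+-monoʳ-≤ (S n) (f≤ n)))
        (tail h)

      gap : ∀ {m n} → m ℕ.≤ n → ∣ S n ℚ.- S m ∣ ℚ.≤ (+ c ℚ./ suc m)
      gap {m} {n} m≤n = subst (ℚ._≤ (+ c ℚ./ suc m))
        (sym (ℚ.0≤p⇒∣p∣≡p (0≤p-q (S-mono (ℕ.≤⇒≤′ m≤n)))))
        (p-q≤r (ℚ.≤-trans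
          (subst (ℚ._≤ S n ℚ.+ (+ c ℚ./ suc n)) (ℚ.+-identityʳ (S n))
            (ℚ.+-monoʳ-≤ (S n) (frac-≤ 0 1 c (suc n) ℕ.z≤n)))
          (tail (ℕ.≤⇒≤′ m≤n))))

      archimedean : ∀ ε → 0ℚ ℚ.< ε → ∃[ N ] (∀ m → N ℕ.≤ m → (+ c ℚ./ suc m) ℚ.≤ ε)
      archimedean ε@(ℚ.mkℚ (+ suc p) d _) _ = c ℕ.* suc d , λ m h →
        subst ((+ c ℚ./ suc m) ℚ.≤_) (ℚ.↥p/↧p≡p ε)
          (frac-≤ c (suc m) (suc p) (suc d)
            (ℕ.≤-trans h (ℕ.≤-trans (ℕ.n≤1+n m) (ℕ.m≤m+n (suc m) (p ℕ.* suc m)))))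
      archimedean (ℚ.mkℚ (+ zero) d _) (*<* (ℤ.+<+ ()))
      archimedean (ℚ.mkℚ ℤ.-[1+ _ ] d _) (*<* ())

      S-cauchy : IsCauchy S
      S-cauchy ε 0<ε =
        let N , small = archimedean ε 0<ε in
        N , λ m n N≤m N≤n → [ (λ m≤n → subst (ℚ._≤ ε) (dist-sym (S n) (S m))
                                         (ℚ.≤-trans (gap m≤n) (small m N≤m)))
                            , (λ n≤m → ℚ.≤-trans (gap n≤m) (small n N≤n))
                            ]′ (ℕ.≤-total m n)

-- The Riemann zeta function at integers s ≥ 2, where it is the Dirichlet series
-- Σ_{n ≥ 1} 1/nˢ; ζ-term s n is the term of index n + 1.

ζ-term : ℕ → ℕ → ℚ
ζ-term s n = (+ 1 ℚ./ (suc n ℕ.^ s)) {{ℕ.m^n≢0 (suc n) s}}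

private
  ζ-term≥0 : ∀ s n → 0ℚ ℚ.≤ ζ-term s n
  ζ-term≥0 s n = frac-≤ 0 1 1 (suc n ℕ.^ s) {{_}} {{ℕ.m^n≢0 (suc n) s}} ℕ.z≤n

  ζ-term≤ : ∀ s → 2 ℕ.≤ s → ∀ n →
            ζ-term s n ℚ.+ (+ 2 ℚ./ suc (suc n)) ℚ.≤ (+ 2 ℚ./ suc n)
  ζ-term≤ s 2≤s n = ℚ.≤-trans
    (ℚ.+-monoˡ-≤ (+ 2 ℚ./ suc (suc n))
      (frac-≤ 1 (suc n ℕ.^ s) 1 (suc n ℕ.* suc n) {{ℕ.m^n≢0 (suc n) s}} {{_}}
        (ℕ.*-monoʳ-≤ 1 (subst (ℕ._≤ suc n ℕ.^ s) (cong (suc n ℕ.*_) (ℕ.*-identityʳ (suc n)))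
          (ℕ.^-monoʳ-≤ (suc n) 2≤s)))))
    (subst (λ r → (+ 1 ℚ./ (suc n ℕ.* suc n)) ℚ.+ (+ 2 ℚ./ suc (suc n)) ℚ.≤ r)
      (ℚ.+-identityʳ (+ 2 ℚ./ suc n))
      (cross 1 (suc n ℕ.* suc n) 2 (suc (suc n)) 2 (suc n) 0 1
        (≤-by {k = n ℕ.* (1 ℕ.+ n)} (lem n))))
    where
    lem : ∀ n → (1 ℕ.* (2 ℕ.+ n) ℕ.+ 2 ℕ.* ((1 ℕ.+ n) ℕ.* (1 ℕ.+ n))) ℕ.* ((1 ℕ.+ n) ℕ.* 1)
                  ℕ.+ n ℕ.* (1 ℕ.+ n) ≡
                (2 ℕ.* 1 ℕ.+ 0 ℕ.* (1 ℕ.+ n)) ℕ.* (((1 ℕ.+ n) ℕ.* (1 ℕ.+ n)) ℕ.* (2 ℕ.+ n))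
    lem = solve-∀

ζ : (s : ℕ) .{{_ : NonTrivial s}} → ℝ
ζ s = mkℝ (partialSum (ζ-term s))
  (Series.S-cauchy (ζ-term s) (ζ-term≥0 s) 2 (ζ-term≤ s (nonTrivial⇒n>1 s)))

-- π is given by the Leibniz series 4 Σ (−1)ⁿ/(2n+1); π-term n groups its terms
-- of index 2n and 2n+1.

π-term : ℕ → ℚ
π-term n = (+ 4 ℚ./ (1 ℕ.+ 4 ℕ.* n)) ℚ.- (+ 4 ℚ./ (3 ℕ.+ 4 ℕ.* n))

private
  π-term≥0 : ∀ n → 0ℚ ℚ.≤ π-term n
  π-term≥0 n = 0≤p-q (frac-≤ 4 (3 ℕ.+ 4 ℕ.* n) 4 (1 ℕ.+ 4 ℕ.* n)
    (ℕ.*-monoʳ-≤ 4 (ℕ.+-monoˡ-≤ (4 ℕ.* n) {1} {3} (ℕ.s≤s ℕ.z≤n))))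

  π-term≤ : ∀ n → π-term n ℚ.+ (+ 6 ℚ./ suc (suc n)) ℚ.≤ (+ 6 ℚ./ suc n)
  π-term≤ n = subst (ℚ._≤ (+ 6 ℚ./ suc n))
    (move (+ 4 ℚ./ (1 ℕ.+ 4 ℕ.* n)) (+ 6 ℚ./ suc (suc n)) (+ 4 ℚ./ (3 ℕ.+ 4 ℕ.* n)))
    (p-q≤r (cross 4 (1 ℕ.+ 4 ℕ.* n) 6 (suc (suc n)) 4 (3 ℕ.+ 4 ℕ.* n) 6 (suc n)
      (≤-by {k = 88 ℕ.* (n ℕ.* n) ℕ.+ 72 ℕ.* n ℕ.+ 2} (lem n))))
    where
    move : ∀ p q r → (p ℚ.+ q) ℚ.- r ≡ (p ℚ.- r) ℚ.+ q
    move = solve 3 (λ p q r → (p :+ q) :- r := (p :- r) :+ q) refl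
      where open +-*-Solver
    lem : ∀ n → (4 ℕ.* (2 ℕ.+ n) ℕ.+ 6 ℕ.* (1 ℕ.+ 4 ℕ.* n)) ℕ.* ((3 ℕ.+ 4 ℕ.* n) ℕ.* (1 ℕ.+ n))
                  ℕ.+ (88 ℕ.* (n ℕ.* n) ℕ.+ 72 ℕ.* n ℕ.+ 2) ≡
                (4 ℕ.* (1 ℕ.+ n) ℕ.+ 6 ℕ.* (3 ℕ.+ 4 ℕ.* n)) ℕ.* ((1 ℕ.+ 4 ℕ.* n) ℕ.* (2 ℕ.+ n))
    lem = solve-∀

π : ℝ
π = mkℝ (partialSum π-term) (Series.S-cauchy π-term π-term≥0 6 π-term≤)

π#0 : π #0
π#0 = 1ℚ , toWitness {a? = 0ℚ ℚ.<? 1ℚ} _ , 1 , λ n 1≤n →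
  let 1≤π = ℚ.≤-trans (toWitness {a? = 1ℚ ℚ.≤? partialSum π-term 1} _)
                      (Series.S-mono π-term π-term≥0 (ℕ.≤⇒≤′ 1≤n))
  in subst (1ℚ ℚ.≤_) (sym (ℚ.0≤p⇒∣p∣≡p (ℚ.≤-trans (toWitness {a? = 0ℚ ℚ.≤? 1ℚ} _) 1≤π))) 1≤π

ζ/π^ : (s : ℕ) .{{_ : NonTrivial s}} → ℝ
ζ/π^ s = ζ s ÷ π ^ s [ ^-#0 {π} s π#0 ]

IsRational : ℝ → Set
IsRational x = Σ[ r ∈ ℚ ] x ≃ fromℚ r

IsInteger : ℚ → Set
IsInteger p = ∃[ z ] p ≡ z ℚ./ 1

ClearsDenominators : ∀ {n} → ℕ → (Fin n → ℚ) → Set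
ClearsDenominators q r = ∀ i → IsInteger ((+ q ℚ./ 1) ℚ.* r i)

record IsCommonDenominator {n} (r : Fin n → ℚ) (q : ℕ) : Set where
  field
    positive : 0 ℕ.< q
    clears   : ClearsDenominators q r
    least    : ∀ q′ → 0 ℕ.< q′ → ClearsDenominators q′ r → q ℕ.≤ q′

{-# OPTIONS --safe #-}

-- The numbers y_k = ζ(2k+1)/π^(2k+1) are, up to a shift, the moments of a positive measure on
-- the points 1/(πν)².  For integers c_0, …, c_m, not all zero, the form Σ c_i c_j y_(k+i+j)
-- equals Σ_ν (πν)^(-2k-1) C((πν)⁻²)² with C(x) = Σ c_j xʲ.  It is positive, so if all these y
-- are rational with common denominator q it is at least 1/q.  The box principle supplies
-- a C that is small at the nodes ν ≤ m and whose coefficients are bounded by H(3(m+1))^(2j), so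
-- that the terms with ν > m are small as well; the form is then less than 1/(2a+2)!.  Nothing is
-- used about π except π ≥ 3.

module Submission where

open import Defs
open import Data.Fin.Base using (Fin; toℕ)
open import Data.Nat.Base using (ℕ; suc; _+_; _≤_; _!) renaming (_*_ to _·_)
open import Data.Product.Base using (proj₁)

open import Algebra.Bundles using (module CommutativeRing)
import Algebra.Properties.CommutativeSemiring.Exp as Exp
import Data.Fin.Base as Fin
import Data.Fin.Properties as Fin
open import Data.Integer.Base as ℤ using (ℤ; +_)
import Data.Integer.Properties as ℤ
open import Data.Nat.Base as ℕ using (zero; _<_; z≤n; s≤s) renaming (_^_ to _^ⁿ_)
import Data.Nat.DivMod as ℕ
import Data.Nat.Properties as ℕ
open import Data.Nat.Tactic.RingSolver using (solve-∀)
open import Data.Product.Base using (∃-syntax; _×_; _,_; proj₂)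
open import Data.Rational.Base as ℚ using (ℚ; 0ℚ; 1ℚ; ½; ∣_∣)
  renaming (_+_ to _⊕_; _-_ to _⊖_; _*_ to _⊗_; _≤_ to _⩽_; _<_ to _⋖_)
import Data.Rational.Properties as ℚ
open import Data.Rational.Solver using (module +-*-Solver)
import Data.Rational.Unnormalised.Base as ℚᵘ
import Data.Rational.Unnormalised.Properties as ℚᵘ
open import Data.Sum.Base using (inj₁; inj₂)
open import Data.Unit.Base using (tt)
open import Relation.Binary.Definitions using (tri<; tri≈; tri>)
open import Relation.Binary.PropositionalEquality
open import Relation.Nullary.Decidable using (Dec; yes; no; ¬?; decidable-stable; toWitness; _×-dec_)
open import Relation.Nullary.Negation using (¬_; contradiction)

open Exp (CommutativeRing.commutativeSemiring ℚ.+-*-commutativeRing)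
  using () renaming (_^_ to _↑_; ^-homo-* to ↑-+; ^-assocʳ to ↑-↑; ^-distrib-* to ↑-⊗)

-- Parameters for the box principle

-- The degree m is floor(a/2), the largest for which the 2m+1 entries of the form are available; for
-- odd a the lowest moment is dropped. Put M = m+1 and θ = M/ν. The coefficient bound makes each
-- term of C at node ν at most Hθ^(2j). For ν ≥ M this alone gives |C| ≤ HM = L. For ν ≤ m and
-- natural coefficients, Cθ^(k+1) lies in an interval of length Lθ^b, b = 2a+2, which is cut into
-- cells of length L. About (3M)^(mM) coefficient vectors meet a number of boxes that is only
-- exponential in M², so H = 1 is enough for large m. The form is then at most 4L²/(3(3M)^(2k)), and
-- this beats 1/b! because b! ≤ 2(b/2)^b and b ≤ 4M. Reals are Cauchy sequences, so the estimates
-- are made over ℚ at a finite stage N, where ζ and π are truncated at the same index and the form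
-- is an exact finite sum of squares. A limit of positive numbers need not be positive; hence a
-- lower bound uniform in N is extracted from a single distant node.

^-distribʳ-* : ∀ m n o → (m · n) ^ⁿ o ≡ m ^ⁿ o · n ^ⁿ o
^-distribʳ-* m n zero    = refl
^-distribʳ-* m n (suc o) = trans (cong (m · n ·_) (^-distribʳ-* m n o)) (lem m n (m ^ⁿ o) (n ^ⁿ o))
  where
  lem : ∀ a b c d → a · b · (c · d) ≡ a · c · (b · d)
  lem = solve-∀

∏ : (ℕ → ℕ) → ℕ → ℕ
∏ f zero    = 1
∏ f (suc n) = ∏ f n · f n

∏-mono-≤ : ∀ {f g : ℕ → ℕ} n → (∀ i → i < n → f i ≤ g i) → ∏ f n ≤ ∏ g n
∏-mono-≤ zero    h = ℕ.≤-refl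
∏-mono-≤ (suc n) h = ℕ.*-mono-≤ (∏-mono-≤ n (λ i i<n → h i (ℕ.m<n⇒m<1+n i<n))) (h n ℕ.≤-refl)

∏-* : ∀ (f g : ℕ → ℕ) n → ∏ (λ i → f i · g i) n ≡ ∏ f n · ∏ g n
∏-* f g zero    = refl
∏-* f g (suc n) = trans (cong (_· (f n · g n)) (∏-* f g n)) (lem (∏ f n) (∏ g n) (f n) (g n))
  where
  lem : ∀ a b c d → a · b · (c · d) ≡ a · c · (b · d)
  lem = solve-∀

∏-const : ∀ c n → ∏ (λ _ → c) n ≡ c ^ⁿ n
∏-const c zero    = refl
∏-const c (suc n) = trans (cong (_· c) (∏-const c n)) (ℕ.*-comm (c ^ⁿ n) c)

∏-suc^ : ∀ b n → ∏ (λ i → suc i ^ⁿ b) n ≡ (n !) ^ⁿ b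
∏-suc^ b zero    = sym (ℕ.^-zeroˡ b)
∏-suc^ b (suc n) = trans (cong (_· suc n ^ⁿ b) (∏-suc^ b n))
  (trans (ℕ.*-comm ((n !) ^ⁿ b) (suc n ^ⁿ b)) (sym (^-distribʳ-* (suc n) (n !) b)))

-- The exponents 0 + 2 + ... + 2n add up to n(n+1); this counts the coefficient vectors up to lower
-- order.
∏-^2j : ∀ c n → ∏ (λ j → c ^ⁿ (2 · j)) (suc n) ≡ c ^ⁿ (n · suc n)
∏-^2j c zero    = refl
∏-^2j c (suc n) = trans (cong (_· c ^ⁿ (2 · suc n)) (∏-^2j c n))
  (trans (sym (ℕ.^-distribˡ-+-* c (n · suc n) (2 · suc n))) (cong (c ^ⁿ_) (lem n)))
  where
  lem : ∀ n → n · suc n + 2 · suc n ≡ suc n · suc (suc n)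
  lem = solve-∀

-- boxes M b n cells of length L cover the interval [0, L(M/(n+1))ᵇ].
abstract
  lastBox : ℕ → ℕ → ℕ → ℕ
  lastBox M b n = (M ^ⁿ b ℕ./ (suc n ^ⁿ b)) {{ℕ.m^n≢0 (suc n) b}}

boxes : ℕ → ℕ → ℕ → ℕ
boxes M b n = suc (lastBox M b n)

-- The growth (3M)^(2j) is matched to the powers of (1/(πν))² at degree j: by π ≥ 3 the product is
-- at most H(M/ν)^(2j).
coeffBound : ℕ → ℕ → ℕ → ℕ
coeffBound H M j = H · (3 · M) ^ⁿ (2 · j)

abstract
  ^<boxes : ∀ M b n → M ^ⁿ b < boxes M b n · suc n ^ⁿ b
  ^<boxes M b n = subst (_< boxes M b n · suc n ^ⁿ b) (sym (ℕ.m≡m%n+[m/n]*n (M ^ⁿ b) (suc n ^ⁿ b)))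
    (ℕ.+-monoˡ-< (lastBox M b n · suc n ^ⁿ b) (ℕ.m%n<n (M ^ⁿ b) (suc n ^ⁿ b)))
    where
    instance
      nz : ℕ.NonZero (suc n ^ⁿ b)
      nz = ℕ.m^n≢0 (suc n) b

  -- For n+1 ≤ M the quotient (M/(n+1))^b is at least 1, so the one additional cell costs at most a
  -- factor 2.
  boxes≤ : ∀ M b n → suc n ≤ M → boxes M b n · suc n ^ⁿ b ≤ 2 · M ^ⁿ b
  boxes≤ M b n le = subst (boxes M b n · suc n ^ⁿ b ≤_) (cong (λ t → M ^ⁿ b + t) (sym (ℕ.+-identityʳ (M ^ⁿ b))))
    (ℕ.+-mono-≤ (ℕ.^-monoˡ-≤ b le) (ℕ.m/n*n≤m (M ^ⁿ b) (suc n ^ⁿ b)))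
    where
    instance
      nz : ℕ.NonZero (suc n ^ⁿ b)
      nz = ℕ.m^n≢0 (suc n) b

-- The first inequality bounds the form by 1/b!, and the second triggers the box principle; b = 2a + 2 when
-- k = lowest m r and a = 2m + r.
Admissible : ℕ → ℕ → ℕ → Set
Admissible m k H = let b = suc k + 2 · m in
  4 · b ! · (H · suc m) ^ⁿ 2 ≤ (3 · suc m) ^ⁿ (2 · k) ×
  ∏ (boxes (suc m) b) m < ∏ (λ j → suc (coeffBound H (suc m) j)) (suc m)

-- For a = 2m + r the moments used are ζ(2k+1)/π^(2k+1) with lowest m r ≤ k ≤ 2a + 1.
lowest : ℕ → ℕ → ℕ
lowest m r = suc (2 · m + 2 · r)

-- Found numerically, for m < 53 only; from there on height 1 suffices.
height : ℕ → ℕ → ℕ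
height m zero    = 2 ^ⁿ (m ℕ.∸ 1)
height m (suc _) = 2 ^ⁿ suc m

admissible? : ∀ m r → Dec (Admissible m (lowest m r) (height m r))
admissible? m r = (_ ℕ.≤? _) ×-dec (_ ℕ.<? _)

abstract
  admissible-below-53 : ∀ {r} → r < 2 → ∀ {m} → m < 53 → Admissible m (lowest m r) (height m r)
  admissible-below-53 =
    toWitness {a? = ℕ.allUpTo? (λ r → ℕ.allUpTo? (λ m → admissible? m r) 53) 2} tt

-- Inequalities for factorials and powers that settle all large m

2^n*n!≤2*n^n : ∀ n → 2 ^ⁿ suc n · suc n ! ≤ 2 · suc n ^ⁿ suc n
2^n*n!≤2*n^n zero    = ℕ.≤-refl
2^n*n!≤2*n^n (suc n) = begin
  2 · 2 ^ⁿ suc n · (suc (suc n) · suc n !)       ≡⟨ lem₁ (2 ^ⁿ suc n) (suc n !) n ⟩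
  2 · suc (suc n) · (2 ^ⁿ suc n · suc n !)       ≤⟨ ℕ.*-monoʳ-≤ (2 · suc (suc n)) (2^n*n!≤2*n^n n) ⟩
  2 · suc (suc n) · (2 · suc n ^ⁿ suc n)         ≤⟨ ℕ.*-monoʳ-≤ (2 · suc (suc n)) (bernoulli (suc n)) ⟩
  2 · suc (suc n) · suc (suc n) ^ⁿ suc n         ≡⟨ ℕ.*-assoc 2 (suc (suc n)) (suc (suc n) ^ⁿ suc n) ⟩
  2 · suc (suc n) ^ⁿ suc (suc n)                 ∎
  where
  open ℕ.≤-Reasoning
  lem₁ : ∀ a b n → 2 · a · (suc (suc n) · b) ≡ 2 · suc (suc n) · (a · b)
  lem₁ = solve-∀
  -- Bernoulli's inequality 1 + c/n ≤ (1 + 1/n)^c with denominators cleared; c = n yields the factor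
  -- 2 of each induction step.
  expand : ∀ c n → n ^ⁿ c · (n + c) ≤ n · suc n ^ⁿ c
  expand zero    n = ℕ.≤-reflexive (lem n)
    where
    lem : ∀ n → 1 · (n + 0) ≡ n · 1
    lem = solve-∀
  expand (suc c) n = begin
    n · n ^ⁿ c · (n + suc c)             ≤⟨ ℕ.m≤m+n _ (n ^ⁿ c · c) ⟩
    n · n ^ⁿ c · (n + suc c) + n ^ⁿ c · c ≡⟨ lem (n ^ⁿ c) n c ⟩
    suc n · (n ^ⁿ c · (n + c))           ≤⟨ ℕ.*-monoʳ-≤ (suc n) (expand c n) ⟩
    suc n · (n · suc n ^ⁿ c)             ≡⟨ lem′ n (suc n ^ⁿ c) ⟩
    n · (suc n · suc n ^ⁿ c)             ∎
    where
    lem : ∀ p n c → n · p · (n + suc c) + p · c ≡ suc n · (p · (n + c))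
    lem = solve-∀
    lem′ : ∀ n p → suc n · (n · p) ≡ n · (suc n · p)
    lem′ = solve-∀
  bernoulli : ∀ n .{{_ : ℕ.NonZero n}} → 2 · n ^ⁿ n ≤ suc n ^ⁿ n
  bernoulli n = ℕ.*-cancelˡ-≤ n (subst (_≤ n · suc n ^ⁿ n) (lem (n ^ⁿ n) n) (expand n n))
    where
    lem : ∀ p n → p · (n + n) ≡ n · (2 · p)
    lem = solve-∀

-- (1 + 1/n)ᶜ ≤ 1 + c/n + c²/n² for c ≤ n, with denominators cleared.
suc^≤ : ∀ {n} c → c ≤ n → n · n · suc n ^ⁿ c ≤ n ^ⁿ c · (n · n + c · n + c · c)
suc^≤ {n} zero    _  = ℕ.≤-reflexive (lem n)
  where
  lem : ∀ n → n · n · 1 ≡ 1 · (n · n + 0 · n + 0 · 0)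
  lem = solve-∀
suc^≤ {n} (suc c) c<n = begin
  n · n · (suc n · suc n ^ⁿ c)                           ≡⟨ lem₁ n (suc n ^ⁿ c) ⟩
  suc n · (n · n · suc n ^ⁿ c)                           ≤⟨ ℕ.*-monoʳ-≤ (suc n) (suc^≤ c (ℕ.<⇒≤ c<n)) ⟩
  suc n · (n ^ⁿ c · (n · n + c · n + c · c))             ≡⟨ lem₂ n c (n ^ⁿ c) ⟩
  n ^ⁿ c · (n · (n · n + suc c · n + c · c + c) + c · c) ≤⟨ ℕ.*-monoʳ-≤ (n ^ⁿ c) (ℕ.+-monoʳ-≤ (n · (n · n + suc c · n + c · c + c)) c·c≤) ⟩
  n ^ⁿ c · (n · (n · n + suc c · n + c · c + c) + n · suc c) ≡⟨ lem₃ n c (n ^ⁿ c) ⟩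
  n · n ^ⁿ c · (n · n + suc c · n + suc c · suc c)       ∎
  where
  open ℕ.≤-Reasoning
  c·c≤ : c · c ≤ n · suc c
  c·c≤ = ℕ.*-mono-≤ (ℕ.<⇒≤ c<n) (ℕ.n≤1+n c)
  lem₁ : ∀ n p → n · n · (suc n · p) ≡ suc n · (n · n · p)
  lem₁ = solve-∀
  lem₂ : ∀ n c p → suc n · (p · (n · n + c · n + c · c)) ≡
                   p · (n · (n · n + suc c · n + c · c + c) + c · c)
  lem₂ = solve-∀
  lem₃ : ∀ n c p → p · (n · (n · n + suc c · n + c · c + c) + n · suc c) ≡
                   n · p · (n · n + suc c · n + suc c · suc c)
  lem₃ = solve-∀

-- Taking c = n in `suc^≤` makes the three summands on the right equal.
suc^n≤3*n^n : ∀ n → suc n ^ⁿ n ≤ 3 · n ^ⁿ n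
suc^n≤3*n^n zero      = s≤s z≤n
suc^n≤3*n^n n@(suc _) = ℕ.*-cancelˡ-≤ (n · n)
  (subst (n · n · suc n ^ⁿ n ≤_) (lem n (n ^ⁿ n)) (suc^≤ n ℕ.≤-refl))
  where
  lem : ∀ n p → p · (n · n + n · n + n · n) ≡ n · n · (3 · p)
  lem = solve-∀

-- Stirling's bound with 3 in the place of e: the step from n to n+1 costs a factor ((n+1)/n)^n,
-- which is at most 3.
n^n≤3^n*n! : ∀ n → n ^ⁿ n ≤ 3 ^ⁿ n · n !
n^n≤3^n*n! zero    = ℕ.≤-refl
n^n≤3^n*n! (suc n) = begin
  suc n · suc n ^ⁿ n         ≤⟨ ℕ.*-monoʳ-≤ (suc n) (ℕ.≤-trans (suc^n≤3*n^n n) (ℕ.*-monoʳ-≤ 3 (n^n≤3^n*n! n))) ⟩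
  suc n · (3 · (3 ^ⁿ n · n !)) ≡⟨ lem (suc n) (3 ^ⁿ n) (n !) ⟩
  3 · 3 ^ⁿ n · (suc n · n !) ∎
  where
  open ℕ.≤-Reasoning
  lem : ∀ a b c → a · (3 · (b · c)) ≡ 3 · b · (a · c)
  lem = solve-∀

-- The inequality still fails at n = 19, so the induction starts at 20; from there on 2(n+1)² ≤ 3n²
-- carries it.
8n²2^n≤3^n : ∀ {n} → 20 ℕ.≤′ n → 8 · (n · n) · 2 ^ⁿ n ≤ 3 ^ⁿ n
8n²2^n≤3^n ℕ.≤′-refl = toWitness {a? = 8 · (20 · 20) · 2 ^ⁿ 20 ℕ.≤? 3 ^ⁿ 20} tt
8n²2^n≤3^n (ℕ.≤′-step {n} 20≤n) = begin
  8 · (suc n · suc n) · (2 · 2 ^ⁿ n) ≡⟨ lem (suc n) (2 ^ⁿ n) ⟩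
  8 · 2 ^ⁿ n · (2 · (suc n · suc n)) ≤⟨ ℕ.*-monoʳ-≤ (8 · 2 ^ⁿ n) quad ⟩
  8 · 2 ^ⁿ n · (3 · (n · n))         ≡⟨ lem′ n (2 ^ⁿ n) ⟩
  3 · (8 · (n · n) · 2 ^ⁿ n)         ≤⟨ ℕ.*-monoʳ-≤ 3 (8n²2^n≤3^n 20≤n) ⟩
  3 · 3 ^ⁿ n                         ∎
  where
  open ℕ.≤-Reasoning
  lem : ∀ n p → 8 · (n · n) · (2 · p) ≡ 8 · p · (2 · (n · n))
  lem = solve-∀
  lem′ : ∀ n p → 8 · p · (3 · (n · n)) ≡ 3 · (8 · (n · n) · p)
  lem′ = solve-∀
  quad : 2 · (suc n · suc n) ≤ 3 · (n · n)
  quad = begin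
    2 · (suc n · suc n)     ≡⟨ eq n ⟩
    2 · (n · n) + (4 · n + 2) ≤⟨ ℕ.+-monoʳ-≤ (2 · (n · n)) (ℕ.+-monoʳ-≤ (4 · n) 2≤n) ⟩
    2 · (n · n) + (4 · n + n) ≡⟨ cong (λ t → 2 · (n · n) + t) (eq″ n) ⟩
    2 · (n · n) + 5 · n     ≤⟨ ℕ.+-monoʳ-≤ (2 · (n · n)) (ℕ.*-monoˡ-≤ n 5≤n) ⟩
    2 · (n · n) + n · n     ≡⟨ eq′ n ⟩
    3 · (n · n)             ∎
    where
    5≤n : 5 ≤ n
    5≤n = ℕ.≤-trans (ℕ.m≤m+n 5 15) (ℕ.≤′⇒≤ 20≤n)
    2≤n : 2 ≤ n
    2≤n = ℕ.≤-trans (ℕ.m≤m+n 2 3) 5≤n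
    eq : ∀ n → 2 · (suc n · suc n) ≡ 2 · (n · n) + (4 · n + 2)
    eq = solve-∀
    eq′ : ∀ n → 2 · (n · n) + n · n ≡ 3 · (n · n)
    eq′ = solve-∀
    eq″ : ∀ n → 4 · n + n ≡ 5 · n
    eq″ = solve-∀


-- Here b! ≤ 2(b/2)^b ≤ 2(2M)^b, and the remaining factor (3/2)^b absorbs the polynomial 8M². This
-- is the first half of `Admissible` at height 1, with the exponent b instead of 2k.
factorial-bound : ∀ M b → M ≤ b → b ≤ 4 · M → 20 ≤ b → 4 · b ! · (1 · M) ^ⁿ 2 ≤ (3 · M) ^ⁿ b
factorial-bound M b@(suc b′) M≤b b≤4M 20≤b = ℕ.*-cancelʳ-≤ _ _ (2 ^ⁿ b) {{ℕ.m^n≢0 2 b}} (begin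
  4 · b ! · (1 · M) ^ⁿ 2 · 2 ^ⁿ b      ≡⟨ lem (b !) M (2 ^ⁿ b) ⟩
  4 · (M · M) · (2 ^ⁿ b · b !)         ≤⟨ ℕ.*-monoʳ-≤ (4 · (M · M)) (2^n*n!≤2*n^n b′) ⟩
  4 · (M · M) · (2 · b ^ⁿ b)           ≤⟨ ℕ.*-monoʳ-≤ (4 · (M · M)) (ℕ.*-monoʳ-≤ 2 (ℕ.^-monoˡ-≤ b b≤4M)) ⟩
  4 · (M · M) · (2 · (4 · M) ^ⁿ b)     ≡⟨ cong (λ x → 4 · (M · M) · (2 · x)) 4M^b ⟩
  4 · (M · M) · (2 · (2 ^ⁿ b · (2 · M) ^ⁿ b)) ≡⟨ lem′ (M · M) (2 ^ⁿ b) ((2 · M) ^ⁿ b) ⟩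
  8 · (M · M) · 2 ^ⁿ b · (2 · M) ^ⁿ b  ≤⟨ ℕ.*-monoˡ-≤ ((2 · M) ^ⁿ b) (ℕ.*-monoˡ-≤ (2 ^ⁿ b) (ℕ.*-monoʳ-≤ 8 (ℕ.*-mono-≤ M≤b M≤b))) ⟩
  8 · (b · b) · 2 ^ⁿ b · (2 · M) ^ⁿ b  ≤⟨ ℕ.*-monoˡ-≤ ((2 · M) ^ⁿ b) (8n²2^n≤3^n (ℕ.≤⇒≤′ 20≤b)) ⟩
  3 ^ⁿ b · (2 · M) ^ⁿ b                ≡⟨ cong (3 ^ⁿ b ·_) (^-distribʳ-* 2 M b) ⟩
  3 ^ⁿ b · (2 ^ⁿ b · M ^ⁿ b)           ≡⟨ lem″ (3 ^ⁿ b) (2 ^ⁿ b) (M ^ⁿ b) ⟩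
  3 ^ⁿ b · M ^ⁿ b · 2 ^ⁿ b             ≡⟨ cong (_· 2 ^ⁿ b) (^-distribʳ-* 3 M b) ⟨
  (3 · M) ^ⁿ b · 2 ^ⁿ b                ∎)
  where
  open ℕ.≤-Reasoning
  4M^b : (4 · M) ^ⁿ b ≡ 2 ^ⁿ b · (2 · M) ^ⁿ b
  4M^b = trans (cong (_^ⁿ b) (ℕ.*-assoc 2 2 M)) (^-distribʳ-* 2 (2 · M) b)
  lem : ∀ f m p → 4 · f · (1 · m · (1 · m · 1)) · p ≡ 4 · (m · m) · (p · f)
  lem = solve-∀
  lem′ : ∀ m p q → 4 · m · (2 · (p · q)) ≡ 8 · m · p · q
  lem′ = solve-∀
  lem″ : ∀ x y z → x · (y · z) ≡ x · z · y
  lem″ = solve-∀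

-- Multiplied by (M!)^b, the left side becomes at most 2^m (M^M)^b, and M^M ≤ 3^M M! removes the
-- factorials again. What is left to compare is 2^m 3^(Mb) ≤ 2^m 81^(M²) with (3M)^(mM).
crowding-bound : ∀ m b → 53 ≤ m → b ≤ 4 · suc m →
                 ∏ (boxes (suc m) b) m < ∏ (λ j → suc (coeffBound 1 (suc m) j)) (suc m)
crowding-bound m b 53≤m b≤4M = ℕ.*-cancelʳ-< ((M !) ^ⁿ b) _ _ (begin-strict
  ∏ (boxes M b) m · (M !) ^ⁿ b                    ≡⟨ cong (∏ (boxes M b) m ·_) (^-distribʳ-* M (m !) b) ⟩
  ∏ (boxes M b) m · (M ^ⁿ b · (m !) ^ⁿ b)         ≡⟨ lem₁ (∏ (boxes M b) m) (M ^ⁿ b) ((m !) ^ⁿ b) ⟩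
  ∏ (boxes M b) m · (m !) ^ⁿ b · M ^ⁿ b           ≤⟨ ℕ.*-monoˡ-≤ (M ^ⁿ b) nodes ⟩
  (2 · M ^ⁿ b) ^ⁿ m · M ^ⁿ b                    ≡⟨ cong (_· M ^ⁿ b) (^-distribʳ-* 2 (M ^ⁿ b) m) ⟩
  2 ^ⁿ m · (M ^ⁿ b) ^ⁿ m · M ^ⁿ b               ≡⟨ lem₂ (2 ^ⁿ m) ((M ^ⁿ b) ^ⁿ m) (M ^ⁿ b) ⟩
  2 ^ⁿ m · (M ^ⁿ b) ^ⁿ M                        ≡⟨ cong (2 ^ⁿ m ·_) (^-swap M b M) ⟩
  2 ^ⁿ m · (M ^ⁿ M) ^ⁿ b                        ≤⟨ ℕ.*-monoʳ-≤ (2 ^ⁿ m) (ℕ.^-monoˡ-≤ b (n^n≤3^n*n! M)) ⟩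
  2 ^ⁿ m · (3 ^ⁿ M · M !) ^ⁿ b                  ≡⟨ cong (2 ^ⁿ m ·_) (^-distribʳ-* (3 ^ⁿ M) (M !) b) ⟩
  2 ^ⁿ m · ((3 ^ⁿ M) ^ⁿ b · (M !) ^ⁿ b)           ≡⟨ ℕ.*-assoc (2 ^ⁿ m) ((3 ^ⁿ M) ^ⁿ b) ((M !) ^ⁿ b) ⟨
  2 ^ⁿ m · (3 ^ⁿ M) ^ⁿ b · (M !) ^ⁿ b             <⟨ ℕ.*-monoˡ-< ((M !) ^ⁿ b) {{ℕ.m^n≢0 (M !) b {{M ℕ.!≢0}}}} powers ⟩
  (3 · M) ^ⁿ (m · M) · (M !) ^ⁿ b                 ≡⟨ cong (_· (M !) ^ⁿ b) (∏-^2j (3 · M) m) ⟨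
  ∏ (λ j → (3 · M) ^ⁿ (2 · j)) M · (M !) ^ⁿ b     ≤⟨ ℕ.*-monoˡ-≤ ((M !) ^ⁿ b) (∏-mono-≤ M (λ j _ → ℕ.≤-trans (ℕ.≤-reflexive (sym (ℕ.*-identityˡ _))) (ℕ.n≤1+n _))) ⟩
  ∏ (λ j → suc (coeffBound 1 M j)) M · (M !) ^ⁿ b ∎)
  where
  open ℕ.≤-Reasoning
  M = suc m
  lem₁ : ∀ x y z → x · (y · z) ≡ x · z · y
  lem₁ = solve-∀
  lem₂ : ∀ x y z → x · y · z ≡ x · (z · y)
  lem₂ = solve-∀
  ^-swap : ∀ x p q → (x ^ⁿ p) ^ⁿ q ≡ (x ^ⁿ q) ^ⁿ p
  ^-swap x p q = trans (ℕ.^-*-assoc x p q) (trans (cong (x ^ⁿ_) (ℕ.*-comm p q)) (sym (ℕ.^-*-assoc x q p)))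
  nodes : ∏ (boxes M b) m · (m !) ^ⁿ b ≤ (2 · M ^ⁿ b) ^ⁿ m
  nodes = begin
    ∏ (boxes M b) m · (m !) ^ⁿ b                  ≡⟨ cong (∏ (boxes M b) m ·_) (∏-suc^ b m) ⟨
    ∏ (boxes M b) m · ∏ (λ i → suc i ^ⁿ b) m    ≡⟨ ∏-* (boxes M b) (λ i → suc i ^ⁿ b) m ⟨
    ∏ (λ i → boxes M b i · suc i ^ⁿ b) m        ≤⟨ ∏-mono-≤ m (λ i i<m → boxes≤ M b i (ℕ.m<n⇒m<1+n i<m)) ⟩
    ∏ (λ _ → 2 · M ^ⁿ b) m                      ≡⟨ ∏-const (2 · M ^ⁿ b) m ⟩
    (2 · M ^ⁿ b) ^ⁿ m                           ∎
  -- This is where 53 comes from: m ≥ 53 means 3M ≥ 162 = 2·81, and 2^m ≥ 256 pays for the remaining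
  -- factor 162.
  base : 2 · 81 ^ⁿ M ≤ (3 · M) ^ⁿ m
  base = begin
    2 · (81 · 81 ^ⁿ m)  ≡⟨ ℕ.*-assoc 2 81 (81 ^ⁿ m) ⟨
    162 · 81 ^ⁿ m       ≤⟨ ℕ.*-monoˡ-≤ (81 ^ⁿ m) (ℕ.≤-trans (ℕ.m≤m+n 162 94) (ℕ.^-monoʳ-≤ 2 (ℕ.≤-trans (ℕ.m≤m+n 8 45) 53≤m))) ⟩
    2 ^ⁿ m · 81 ^ⁿ m    ≡⟨ ^-distribʳ-* 2 81 m ⟨
    162 ^ⁿ m            ≤⟨ ℕ.^-monoˡ-≤ m (ℕ.*-monoʳ-≤ 3 (s≤s 53≤m)) ⟩
    (3 · M) ^ⁿ m        ∎
  powers : 2 ^ⁿ m · (3 ^ⁿ M) ^ⁿ b < (3 · M) ^ⁿ (m · M)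
  powers = begin-strict
    2 ^ⁿ m · (3 ^ⁿ M) ^ⁿ b        ≤⟨ ℕ.*-monoʳ-≤ (2 ^ⁿ m) (ℕ.^-monoʳ-≤ (3 ^ⁿ M) {{ℕ.m^n≢0 3 M}} b≤4M) ⟩
    2 ^ⁿ m · (3 ^ⁿ M) ^ⁿ (4 · M)  ≡⟨ cong (2 ^ⁿ m ·_) (trans (sym (ℕ.^-*-assoc (3 ^ⁿ M) 4 M)) (cong (_^ⁿ M) (^-swap 3 M 4))) ⟩
    2 ^ⁿ m · (81 ^ⁿ M) ^ⁿ M       <⟨ ℕ.*-monoˡ-< ((81 ^ⁿ M) ^ⁿ M) {{ℕ.m^n≢0 (81 ^ⁿ M) M {{ℕ.m^n≢0 81 M}}}} (ℕ.^-monoʳ-< 2 (s≤s (s≤s z≤n)) (ℕ.n<1+n m)) ⟩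
    2 ^ⁿ M · (81 ^ⁿ M) ^ⁿ M       ≡⟨ ^-distribʳ-* 2 (81 ^ⁿ M) M ⟨
    (2 · 81 ^ⁿ M) ^ⁿ M            ≤⟨ ℕ.^-monoˡ-≤ M base ⟩
    ((3 · M) ^ⁿ m) ^ⁿ M           ≡⟨ ℕ.^-*-assoc (3 · M) m M ⟩
    (3 · M) ^ⁿ (m · M)            ∎

admissible-from-53 : ∀ {r} → r < 2 → ∀ {m} → 53 ≤ m → Admissible m (lowest m r) 1
admissible-from-53 {r} (s≤s r≤1) {m} 53≤m =
    -- Since 2k = b + 2r, raising the exponent from b to 2k only enlarges the right side.
    ℕ.≤-trans (factorial-bound M b M≤b b≤4M 20≤b) (ℕ.^-monoʳ-≤ (3 · M) b≤)
  , crowding-bound m b 53≤m b≤4M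
  where
  M = suc m
  b = suc (lowest m r) + 2 · m
  eq₁ : ∀ m r → suc (suc (2 · m + 2 · r)) + 2 · m ≡ suc m + (3 · m + 2 · r + 1)
  eq₁ = solve-∀
  eq₂ : ∀ m → suc (suc (2 · m + 2 · 1)) + 2 · m ≡ 4 · suc m
  eq₂ = solve-∀
  eq₃ : ∀ m r → 2 · suc (2 · m + 2 · r) ≡ suc (suc (2 · m + 2 · r)) + 2 · m + 2 · r
  eq₃ = solve-∀
  M≤b : M ≤ b
  M≤b = ℕ.≤-trans (ℕ.m≤m+n M _) (ℕ.≤-reflexive (sym (eq₁ m r)))
  b≤4M : b ≤ 4 · M
  b≤4M = ℕ.≤-trans (ℕ.+-monoˡ-≤ (2 · m) (s≤s (s≤s (ℕ.+-monoʳ-≤ (2 · m) (ℕ.*-monoʳ-≤ 2 r≤1))))) (ℕ.≤-reflexive (eq₂ m))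
  20≤b : 20 ≤ b
  20≤b = ℕ.≤-trans (ℕ.≤-trans (ℕ.m≤m+n 20 33) 53≤m) (ℕ.≤-trans (ℕ.n≤1+n m) M≤b)
  b≤ : b ≤ 2 · lowest m r
  b≤ = ℕ.≤-trans (ℕ.m≤m+n b (2 · r)) (ℕ.≤-reflexive (sym (eq₃ m r)))

admissible : ∀ {r} → r < 2 → ∀ m → ∃[ H ] Admissible m (lowest m r) H
admissible {r} r<2 m with m ℕ.<? 53
... | yes m<53 = height m r , admissible-below-53 r<2 m<53
... | no  m≮53 = 1 , admissible-from-53 r<2 (ℕ.≮⇒≥ m≮53)

-- The box principle

-- Mixed-radix digits, by which the numbers below the product enumerate coefficient vectors.
-- Positions from n on read 0, so digit bounds hold at every index.
digit : ∀ (h : ℕ → ℕ) n → Fin (∏ h n) → ℕ → ℕ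
digit h zero    x j = 0
digit h (suc n) x j with j ℕ.≟ n
... | yes _ = toℕ (proj₂ (Fin.remQuot {∏ h n} (h n) x))
... | no  _ = digit h n (proj₁ (Fin.remQuot {∏ h n} (h n) x)) j

digit≤ : ∀ (g : ℕ → ℕ) n x j → digit (λ i → suc (g i)) n x j ≤ g j
digit≤ g zero    x j = z≤n
digit≤ g (suc n) x j with j ℕ.≟ n
... | yes refl = Fin.toℕ≤pred[n] _
... | no  _    = digit≤ g n _ j

digit-injective : ∀ (h : ℕ → ℕ) n {x y} → (∀ j → j < n → digit h n x j ≡ digit h n y j) → x ≡ y
digit-injective h zero    {Fin.zero} {Fin.zero} _ = refl
digit-injective h (suc n) {x} {y} eq = begin
  x                                     ≡⟨ Fin.combine-remQuot {∏ h n} (h n) x ⟨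
  Fin.combine (proj₁ xs) (proj₂ xs)     ≡⟨ cong₂ Fin.combine (digit-injective h n low) (Fin.toℕ-injective (top eq)) ⟩
  Fin.combine (proj₁ ys) (proj₂ ys)     ≡⟨ Fin.combine-remQuot {∏ h n} (h n) y ⟩
  y                                     ∎
  where
  open ≡-Reasoning
  xs = Fin.remQuot {∏ h n} (h n) x
  ys = Fin.remQuot {∏ h n} (h n) y
  top : (∀ j → j < suc n → digit h (suc n) x j ≡ digit h (suc n) y j) → toℕ (proj₂ xs) ≡ toℕ (proj₂ ys)
  top eq with eq n ℕ.≤-refl
  ... | e with n ℕ.≟ n
  ...   | yes _  = e
  ...   | no n≢n = contradiction refl n≢n
  low : ∀ j → j < n → digit h n (proj₁ xs) j ≡ digit h n (proj₁ ys) j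
  low j j<n with eq j (ℕ.m<n⇒m<1+n j<n)
  ... | e with j ℕ.≟ n
  ...   | yes refl = contradiction j<n (ℕ.<-irrefl refl)
  ...   | no  _    = e

pack : ∀ {b : ℕ → ℕ} n → (∀ i → Fin (b i)) → Fin (∏ b n)
pack zero    f = Fin.zero
pack (suc n) f = Fin.combine (pack n f) (f n)

pack-injective : ∀ {b : ℕ → ℕ} n {f g : ∀ i → Fin (b i)} → pack n f ≡ pack n g → ∀ i → i < n → f i ≡ g i
pack-injective {b} (suc n) {f} {g} eq i (s≤s i≤n) 
  with Fin.combine-injective (pack n f) (f n) (pack n g) (g n) eq | ℕ.m≤n⇒m<n∨m≡n i≤n
... | low , _   | inj₁ i<n  = pack-injective n low i i<n
... | _   , top | inj₂ refl = top

-- The m cells of a vector are packed into one mixed-radix number, which leaves a single pigeonhole.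
-- It returns two distinct codes; a bounded search turns this into a position where the digits
-- differ.
box-principle : ∀ {g b : ℕ → ℕ} {D m} → ∏ b m < ∏ (λ j → suc (g j)) D →
  (cell : (c : ℕ → ℕ) → (∀ j → c j ≤ g j) → ∀ i → Fin (b i)) →
  ∃[ c ] ∃[ d ] ∃[ c≤g ] ∃[ d≤g ] (∃[ j ] (j < D × c j ≢ d j)) ×
    (∀ i → i < m → cell c c≤g i ≡ cell d d≤g i)
box-principle {g} {b} {D} {m} lt cell
  with Fin.pigeonhole lt (λ x → pack m (cell (digit _ D x) (digit≤ g D x)))
... | x , y , x<y , eq = digit _ D x , digit _ D y , digit≤ g D x , digit≤ g D y , differ , pack-injective m eq
  where
  differ : ∃[ j ] (j < D × digit _ D x j ≢ digit _ D y j)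
  differ with ℕ.anyUpTo? (λ j → ¬? (digit (λ i → suc (g i)) D x j ℕ.≟ digit _ D y j)) D
  ... | yes p = p
  ... | no ¬p = contradiction
    (digit-injective _ D (λ j j<D → decidable-stable (_ ℕ.≟ _) (λ ne → ¬p (j , j<D , ne)))) (Fin.<⇒≢ x<y)

-- Ordered field lemmas for ℚ

0≤1 : 0ℚ ⩽ 1ℚ
0≤1 = toWitness {a? = 0ℚ ℚ.≤? 1ℚ} tt

0<1 : 0ℚ ⋖ 1ℚ
0<1 = toWitness {a? = 0ℚ ℚ.<? 1ℚ} tt

⊗-monoʳ : ∀ {p q r} → 0ℚ ⩽ p → q ⩽ r → p ⊗ q ⩽ p ⊗ r
⊗-monoʳ {p} 0≤p = ℚ.*-monoˡ-≤-nonNeg p {{ℚ.nonNegative 0≤p}}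

⊗-monoˡ : ∀ {p q r} → 0ℚ ⩽ p → q ⩽ r → q ⊗ p ⩽ r ⊗ p
⊗-monoˡ {p} 0≤p = ℚ.*-monoʳ-≤-nonNeg p {{ℚ.nonNegative 0≤p}}

⊗-mono : ∀ {p q r s} → 0ℚ ⩽ p → 0ℚ ⩽ s → p ⩽ q → r ⩽ s → p ⊗ r ⩽ q ⊗ s
⊗-mono 0≤p 0≤s p≤q r≤s = ℚ.≤-trans (⊗-monoʳ 0≤p r≤s) (⊗-monoˡ 0≤s p≤q)

⊗-nonNeg : ∀ {p q} → 0ℚ ⩽ p → 0ℚ ⩽ q → 0ℚ ⩽ p ⊗ q
⊗-nonNeg {p} 0≤p 0≤q = subst (_⩽ p ⊗ _) (ℚ.*-zeroʳ p) (⊗-monoʳ 0≤p 0≤q)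

⊗-pos : ∀ {p q} → 0ℚ ⋖ p → 0ℚ ⋖ q → 0ℚ ⋖ p ⊗ q
⊗-pos {p} {q} 0<p 0<q = ℚ.positive⁻¹ (p ⊗ q)
  {{ℚ.pos*pos⇒pos p {{ℚ.positive 0<p}} q {{ℚ.positive 0<q}}}}

⊗-cancelˡ-≤ : ∀ {p q r} → 0ℚ ⋖ p → p ⊗ q ⩽ p ⊗ r → q ⩽ r
⊗-cancelˡ-≤ {p} 0<p = ℚ.*-cancelˡ-≤-pos p {{ℚ.positive 0<p}}

⊗-cancelˡ-≡ : ∀ {p q r} → 0ℚ ⋖ p → p ⊗ q ≡ p ⊗ r → q ≡ r
⊗-cancelˡ-≡ 0<p eq = ℚ.≤-antisym (⊗-cancelˡ-≤ 0<p (ℚ.≤-reflexive eq))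
                                 (⊗-cancelˡ-≤ 0<p (ℚ.≤-reflexive (sym eq)))

⊕-nonNeg : ∀ {p q} → 0ℚ ⩽ p → 0ℚ ⩽ q → 0ℚ ⩽ p ⊕ q
⊕-nonNeg 0≤p 0≤q = ℚ.+-mono-≤ 0≤p 0≤q

p≤p⊕q : ∀ {p q} → 0ℚ ⩽ q → p ⩽ p ⊕ q
p≤p⊕q {p} 0≤q = subst (_⩽ p ⊕ _) (ℚ.+-identityʳ p) (ℚ.+-monoʳ-≤ p 0≤q)

⊖-nonNeg : ∀ {p q} → q ⩽ p → 0ℚ ⩽ p ⊖ q
⊖-nonNeg {p} {q} h = subst (_⩽ p ⊖ q) (ℚ.+-inverseʳ q) (ℚ.+-monoˡ-≤ (ℚ.- q) h)

p≤∣p∣ : ∀ p → p ⩽ ∣ p ∣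
p≤∣p∣ p with ℚ.≤-total 0ℚ p
... | inj₁ 0≤p = ℚ.≤-reflexive (sym (ℚ.0≤p⇒∣p∣≡p 0≤p))
... | inj₂ p≤0 = ℚ.≤-trans p≤0 (ℚ.0≤∣p∣ p)

⊕-⊖-cancel : ∀ p q → (p ⊕ q) ⊖ q ≡ p
⊕-⊖-cancel = solve 2 (λ p q → (p :+ q) :- q := p) refl
  where open +-*-Solver

⊖-⊕-cancel : ∀ p q → (p ⊖ q) ⊕ q ≡ p
⊖-⊕-cancel = solve 2 (λ p q → (p :- q) :+ q := p) refl
  where open +-*-Solver

⊖-flip : ∀ p q → p ⊖ q ≡ ℚ.- (q ⊖ p)
⊖-flip = solve 2 (λ p q → p :- q := :- (q :- p)) refl
  where open +-*-Solver

⊕-cancelʳ-≤ : ∀ {p q r} → p ⊕ r ⩽ q ⊕ r → p ⩽ q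
⊕-cancelʳ-≤ {p} {q} {r} h = subst₂ _⩽_ (⊕-⊖-cancel p r) (⊕-⊖-cancel q r) (ℚ.+-monoˡ-≤ (ℚ.- r) h)

p≤q⊕r⇒p⊖q≤r : ∀ {p q r} → p ⩽ q ⊕ r → p ⊖ q ⩽ r
p≤q⊕r⇒p⊖q≤r {p} {q} {r} h = ⊕-cancelʳ-≤ {r = q}
  (subst₂ _⩽_ (sym (⊖-⊕-cancel p q)) (ℚ.+-comm q r) h)

∣p⊖q∣≤ : ∀ {p q r} → p ⩽ q ⊕ r → q ⩽ p ⊕ r → ∣ p ⊖ q ∣ ⩽ r
∣p⊖q∣≤ {p} {q} {r} h k with ℚ.∣p∣≡p∨∣p∣≡-p (p ⊖ q)
... | inj₁ eq = subst (_⩽ r) (sym eq) (p≤q⊕r⇒p⊖q≤r h)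
... | inj₂ eq = subst (_⩽ r) (trans (⊖-flip q p) (sym eq)) (p≤q⊕r⇒p⊖q≤r k)

∣p⊖q∣≤⇒p≤ : ∀ p q {r} → ∣ p ⊖ q ∣ ⩽ r → p ⩽ q ⊕ r
∣p⊖q∣≤⇒p≤ p q {r} h = subst (_⩽ q ⊕ r) (trans (ℚ.+-comm q (p ⊖ q)) (⊖-⊕-cancel p q))
  (ℚ.+-monoʳ-≤ q (ℚ.≤-trans (p≤∣p∣ (p ⊖ q)) h))

∣p⊖q∣≤⇒q≤ : ∀ p q {r} → ∣ p ⊖ q ∣ ⩽ r → q ⩽ p ⊕ r
∣p⊖q∣≤⇒q≤ p q h = ∣p⊖q∣≤⇒p≤ q p (ℚ.≤-trans (ℚ.≤-reflexive (trans (cong ∣_∣ (⊖-flip q p)) (ℚ.∣-p∣≡∣p∣ (p ⊖ q)))) h)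

∣∣-⊗ : ∀ p {q} → 0ℚ ⩽ q → ∣ p ⊗ q ∣ ≡ ∣ p ∣ ⊗ q
∣∣-⊗ p {q} 0≤q = trans (ℚ.∣p*q∣≡∣p∣*∣q∣ p q) (cong (∣ p ∣ ⊗_) (ℚ.0≤p⇒∣p∣≡p 0≤q))

square≡∣∣² : ∀ p → p ⊗ p ≡ ∣ p ∣ ⊗ ∣ p ∣
square≡∣∣² p with ℚ.∣p∣≡p∨∣p∣≡-p p
... | inj₁ eq = sym (cong₂ _⊗_ eq eq)
... | inj₂ eq = trans (lem p) (sym (cong₂ _⊗_ eq eq))
  where
  lem : ∀ p → p ⊗ p ≡ (ℚ.- p) ⊗ (ℚ.- p)
  lem = solve 1 (λ p → p :* p := (:- p) :* (:- p)) refl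
    where open +-*-Solver

-- ℤ and ℕ inside ℚ

ιᶻ : ℤ → ℚ
ιᶻ z = z ℚ./ 1

toℚᵘ-ιᶻ : ∀ z → ℚ.toℚᵘ (ιᶻ z) ℚᵘ.≃ ℚᵘ.mkℚᵘ z 0
toℚᵘ-ιᶻ z = ℚ.toℚᵘ-fromℚᵘ (ℚᵘ.mkℚᵘ z 0)

ιᶻ-+ : ∀ y z → ιᶻ (y ℤ.+ z) ≡ ιᶻ y ⊕ ιᶻ z
ιᶻ-+ y z = ℚ.toℚᵘ-injective (begin
  ℚ.toℚᵘ (ιᶻ (y ℤ.+ z))                      ≈⟨ toℚᵘ-ιᶻ (y ℤ.+ z) ⟩
  ℚᵘ.mkℚᵘ (y ℤ.+ z) 0                        ≈⟨ ℚᵘ.*≡* (cong (ℤ._* + 1) (sym (cong₂ ℤ._+_ (ℤ.*-identityʳ y) (ℤ.*-identityʳ z)))) ⟩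
  ℚᵘ.mkℚᵘ y 0 ℚᵘ.+ ℚᵘ.mkℚᵘ z 0               ≈⟨ ℚᵘ.+-cong (toℚᵘ-ιᶻ y) (toℚᵘ-ιᶻ z) ⟨
  ℚ.toℚᵘ (ιᶻ y) ℚᵘ.+ ℚ.toℚᵘ (ιᶻ z)           ≈⟨ ℚ.toℚᵘ-homo-+ (ιᶻ y) (ιᶻ z) ⟨
  ℚ.toℚᵘ (ιᶻ y ⊕ ιᶻ z)                       ∎)
  where open ℚᵘ.≃-Reasoning

ιᶻ-* : ∀ y z → ιᶻ (y ℤ.* z) ≡ ιᶻ y ⊗ ιᶻ z
ιᶻ-* y z = ℚ.toℚᵘ-injective (begin
  ℚ.toℚᵘ (ιᶻ (y ℤ.* z))                      ≈⟨ toℚᵘ-ιᶻ (y ℤ.* z) ⟩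
  ℚᵘ.mkℚᵘ (y ℤ.* z) 0                        ≈⟨ ℚᵘ.*≡* refl ⟩
  ℚᵘ.mkℚᵘ y 0 ℚᵘ.* ℚᵘ.mkℚᵘ z 0               ≈⟨ ℚᵘ.*-cong (toℚᵘ-ιᶻ y) (toℚᵘ-ιᶻ z) ⟨
  ℚ.toℚᵘ (ιᶻ y) ℚᵘ.* ℚ.toℚᵘ (ιᶻ z)           ≈⟨ ℚ.toℚᵘ-homo-* (ιᶻ y) (ιᶻ z) ⟨
  ℚ.toℚᵘ (ιᶻ y ⊗ ιᶻ z)                       ∎)
  where open ℚᵘ.≃-Reasoning

ιᶻ-cancel-< : ∀ {y z} → ιᶻ y ⋖ ιᶻ z → y ℤ.< z
ιᶻ-cancel-< {y} {z} h with ℚᵘ.<-respˡ-≃ (toℚᵘ-ιᶻ y) (ℚᵘ.<-respʳ-≃ (toℚᵘ-ιᶻ z) (ℚ.toℚᵘ-mono-< h))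
... | ℚᵘ.*<* lt = subst₂ ℤ._<_ (ℤ.*-identityʳ y) (ℤ.*-identityʳ z) lt

ιᶻ-mono-≤ : ∀ {y z} → y ℤ.≤ z → ιᶻ y ⩽ ιᶻ z
ιᶻ-mono-≤ {y} {z} h = ℚ.toℚᵘ-cancel-≤
  (ℚᵘ.≤-respˡ-≃ (ℚᵘ.≃-sym (toℚᵘ-ιᶻ y)) (ℚᵘ.≤-respʳ-≃ (ℚᵘ.≃-sym (toℚᵘ-ιᶻ z))
    (ℚᵘ.*≤* (subst₂ ℤ._≤_ (sym (ℤ.*-identityʳ y)) (sym (ℤ.*-identityʳ z)) h))))

ιᶻ-mono-< : ∀ {y z} → y ℤ.< z → ιᶻ y ⋖ ιᶻ z
ιᶻ-mono-< {y} {z} h = ℚ.toℚᵘ-cancel-<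
  (ℚᵘ.<-respˡ-≃ (ℚᵘ.≃-sym (toℚᵘ-ιᶻ y)) (ℚᵘ.<-respʳ-≃ (ℚᵘ.≃-sym (toℚᵘ-ιᶻ z))
    (ℚᵘ.*<* (subst₂ ℤ._<_ (sym (ℤ.*-identityʳ y)) (sym (ℤ.*-identityʳ z)) h))))

abstract
  ι : ℕ → ℚ
  ι n = ιᶻ (+ n)

  rec : ℕ → ℚ
  rec n = + 1 ℚ./ suc n

  ι≡ : ∀ n → ι n ≡ + n ℚ./ 1
  ι≡ n = refl

  ι-0 : ι 0 ≡ 0ℚ
  ι-0 = refl

  ι-1 : ι 1 ≡ 1ℚ
  ι-1 = refl

  ι-+ : ∀ m n → ι (m + n) ≡ ι m ⊕ ι n
  ι-+ m n = ιᶻ-+ (+ m) (+ n)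

  ι-· : ∀ m n → ι (m · n) ≡ ι m ⊗ ι n
  ι-· m n = trans (cong ιᶻ (ℤ.pos-* m n)) (ιᶻ-* (+ m) (+ n))

  ι-mono-≤ : ∀ {m n} → m ≤ n → ι m ⩽ ι n
  ι-mono-≤ h = ιᶻ-mono-≤ (ℤ.+≤+ h)

  ι-mono-< : ∀ {m n} → m < n → ι m ⋖ ι n
  ι-mono-< h = ιᶻ-mono-< (ℤ.+<+ h)

  IsInteger-ι : ∀ n → IsInteger (ι n)
  IsInteger-ι n = + n , refl

  rec≡ : ∀ n → rec n ≡ + 1 ℚ./ suc n
  rec≡ n = refl

  rec-pos : ∀ n → 0ℚ ⋖ rec n
  rec-pos n = ℚ.positive⁻¹ (rec n) {{ℚ.normalize-pos 1 (suc n)}}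

  ι⊗rec : ∀ n → ι (suc n) ⊗ rec n ≡ 1ℚ
  ι⊗rec n = ℚ.toℚᵘ-injective (begin
    ℚ.toℚᵘ (ι (suc n) ⊗ rec n)                       ≈⟨ ℚ.toℚᵘ-homo-* (ι (suc n)) (rec n) ⟩
    ℚ.toℚᵘ (ι (suc n)) ℚᵘ.* ℚ.toℚᵘ (rec n)           ≈⟨ ℚᵘ.*-cong (toℚᵘ-ιᶻ (+ suc n)) (ℚ.toℚᵘ-fromℚᵘ (ℚᵘ.mkℚᵘ (+ 1) n)) ⟩
    ℚᵘ.mkℚᵘ (+ suc n) 0 ℚᵘ.* ℚᵘ.mkℚᵘ (+ 1) n         ≈⟨ ℚᵘ.*≡* (cong +_ (lem n)) ⟩
    ℚ.toℚᵘ 1ℚ                                        ∎)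
    where
    open ℚᵘ.≃-Reasoning
    lem : ∀ n → suc n · 1 · 1 ≡ suc (n + 0 + 0)
    lem = solve-∀


ι-^ : ∀ m n → ι (m ^ⁿ n) ≡ ι m ↑ n
ι-^ m zero    = ι-1
ι-^ m (suc n) = trans (ι-· m (m ^ⁿ n)) (cong (ι m ⊗_) (ι-^ m n))

ι-nonNeg : ∀ n → 0ℚ ⩽ ι n
ι-nonNeg n = subst (_⩽ ι n) ι-0 (ι-mono-≤ z≤n)

1≤ι : ∀ {n} → 1 ≤ n → 1ℚ ⩽ ι n
1≤ι {n} 1≤n = subst (_⩽ ι n) ι-1 (ι-mono-≤ 1≤n)

ι-pos : ∀ n → 0ℚ ⋖ ι (suc n)
ι-pos n = ℚ.<-≤-trans 0<1 (1≤ι (s≤s z≤n))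

IsInteger-⊕ : ∀ {p q} → IsInteger p → IsInteger q → IsInteger (p ⊕ q)
IsInteger-⊕ (y , refl) (z , refl) = y ℤ.+ z , sym (ιᶻ-+ y z)

IsInteger-⊗ : ∀ {p q} → IsInteger p → IsInteger q → IsInteger (p ⊗ q)
IsInteger-⊗ (y , refl) (z , refl) = y ℤ.* z , sym (ιᶻ-* y z)

IsInteger-⊖ : ∀ {p q} → IsInteger p → IsInteger q → IsInteger (p ⊖ q)
IsInteger-⊖ {p} {q} P Q = subst IsInteger (lem p q)
  (IsInteger-⊕ P (IsInteger-⊗ {ιᶻ (ℤ.- (+ 1))} (ℤ.- (+ 1) , refl) Q))
  where
  lem : ∀ p q → p ⊕ ιᶻ (ℤ.- (+ 1)) ⊗ q ≡ p ⊖ q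
  lem = solve 2 (λ p q → p :+ con (ιᶻ (ℤ.- (+ 1))) :* q := p :- q) refl
    where open +-*-Solver

IsInteger-pos : ∀ {p} → IsInteger p → 0ℚ ⋖ p → 1ℚ ⩽ p
IsInteger-pos (z , refl) 0<p = ιᶻ-mono-≤ (ℤ.i<j⇒suc[i]≤j (ιᶻ-cancel-< {+ 0} {z} 0<p))

rec-unique : ∀ n {p} → ι (suc n) ⊗ p ≡ 1ℚ → p ≡ rec n
rec-unique n eq = ⊗-cancelˡ-≡ (ι-pos n) (trans eq (sym (ι⊗rec n)))

rec-nonNeg : ∀ n → 0ℚ ⩽ rec n
rec-nonNeg n = ℚ.<⇒≤ (rec-pos n)

↑-nonNeg : ∀ {p} n → 0ℚ ⩽ p → 0ℚ ⩽ p ↑ n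
↑-nonNeg zero    0≤p = 0≤1
↑-nonNeg (suc n) 0≤p = ⊗-nonNeg 0≤p (↑-nonNeg n 0≤p)

↑-pos : ∀ {p} n → 0ℚ ⋖ p → 0ℚ ⋖ p ↑ n
↑-pos zero    0<p = 0<1
↑-pos (suc n) 0<p = ⊗-pos 0<p (↑-pos n 0<p)

↑-mono : ∀ {p q} n → 0ℚ ⩽ p → p ⩽ q → p ↑ n ⩽ q ↑ n
↑-mono zero    _   _   = ℚ.≤-refl
↑-mono (suc n) 0≤p p≤q = ⊗-mono 0≤p (↑-nonNeg n (ℚ.≤-trans 0≤p p≤q)) p≤q (↑-mono n 0≤p p≤q)

1↑ : ∀ n → 1ℚ ↑ n ≡ 1ℚ
1↑ zero    = refl
1↑ (suc n) = trans (ℚ.*-identityˡ _) (1↑ n)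

↑≤1 : ∀ {p} n → 0ℚ ⩽ p → p ⩽ 1ℚ → p ↑ n ⩽ 1ℚ
↑≤1 {p} n 0≤p p≤1 = subst (p ↑ n ⩽_) (1↑ n) (↑-mono n 0≤p p≤1)

↑-antimono-exp : ∀ {p m n} → 0ℚ ⩽ p → p ⩽ 1ℚ → m ℕ.≤′ n → p ↑ n ⩽ p ↑ m
↑-antimono-exp 0≤p p≤1 ℕ.≤′-refl = ℚ.≤-refl
↑-antimono-exp {p} 0≤p p≤1 (ℕ.≤′-step {n} h) = ℚ.≤-trans
  (subst (p ⊗ p ↑ n ⩽_) (ℚ.*-identityˡ (p ↑ n)) (⊗-monoˡ (↑-nonNeg n 0≤p) p≤1))
  (↑-antimono-exp 0≤p p≤1 h)

↑-mono-exp : ∀ {p m n} → 1ℚ ⩽ p → m ℕ.≤′ n → p ↑ m ⩽ p ↑ n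
↑-mono-exp 1≤p ℕ.≤′-refl = ℚ.≤-refl
↑-mono-exp {p} 1≤p (ℕ.≤′-step {n} h) = ℚ.≤-trans (↑-mono-exp 1≤p h)
  (subst (_⩽ p ⊗ p ↑ n) (ℚ.*-identityˡ (p ↑ n)) (⊗-monoˡ (↑-nonNeg n (ℚ.≤-trans 0≤1 1≤p)) 1≤p))

-- Finite sums

sum-cong : ∀ {f g : ℕ → ℚ} n → (∀ i → f i ≡ g i) → partialSum f n ≡ partialSum g n
sum-cong zero    h = refl
sum-cong (suc n) h = cong₂ _⊕_ (sum-cong n h) (h n)

sum-mono : ∀ {f g : ℕ → ℚ} n → (∀ i → i < n → f i ⩽ g i) → partialSum f n ⩽ partialSum g n
sum-mono zero    h = ℚ.≤-refl
sum-mono (suc n) h = ℚ.+-mono-≤ (sum-mono n (λ i i<n → h i (ℕ.m<n⇒m<1+n i<n))) (h n ℕ.≤-refl)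

sum-nonNeg : ∀ {f : ℕ → ℚ} n → (∀ i → 0ℚ ⩽ f i) → 0ℚ ⩽ partialSum f n
sum-nonNeg zero    h = ℚ.≤-refl
sum-nonNeg (suc n) h = ⊕-nonNeg (sum-nonNeg n h) (h n)

sum-⊕ : ∀ (f g : ℕ → ℚ) n → partialSum (λ i → f i ⊕ g i) n ≡ partialSum f n ⊕ partialSum g n
sum-⊕ f g zero    = refl
sum-⊕ f g (suc n) = trans (cong (_⊕ (f n ⊕ g n)) (sum-⊕ f g n)) (lem (partialSum f n) (partialSum g n) (f n) (g n))
  where
  lem : ∀ a b c d → (a ⊕ b) ⊕ (c ⊕ d) ≡ (a ⊕ c) ⊕ (b ⊕ d)
  lem = solve 4 (λ a b c d → (a :+ b) :+ (c :+ d) := (a :+ c) :+ (b :+ d)) refl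
    where open +-*-Solver

sum-⊗ˡ : ∀ c (f : ℕ → ℚ) n → partialSum (λ i → c ⊗ f i) n ≡ c ⊗ partialSum f n
sum-⊗ˡ c f zero    = sym (ℚ.*-zeroʳ c)
sum-⊗ˡ c f (suc n) = trans (cong (_⊕ c ⊗ f n) (sum-⊗ˡ c f n)) (sym (ℚ.*-distribˡ-+ c (partialSum f n) (f n)))

sum-⊗ʳ : ∀ c (f : ℕ → ℚ) n → partialSum (λ i → f i ⊗ c) n ≡ partialSum f n ⊗ c
sum-⊗ʳ c f n = trans (sum-cong n (λ i → ℚ.*-comm (f i) c)) (trans (sum-⊗ˡ c f n) (ℚ.*-comm c (partialSum f n)))

sum-⊖ : ∀ (f g : ℕ → ℚ) n → partialSum (λ i → f i ⊖ g i) n ≡ partialSum f n ⊖ partialSum g n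
sum-⊖ f g zero    = refl
sum-⊖ f g (suc n) = trans (cong (_⊕ (f n ⊖ g n)) (sum-⊖ f g n)) (lem (partialSum f n) (partialSum g n) (f n) (g n))
  where
  lem : ∀ a b c d → (a ⊖ b) ⊕ (c ⊖ d) ≡ (a ⊕ c) ⊖ (b ⊕ d)
  lem = solve 4 (λ a b c d → (a :- b) :+ (c :- d) := (a :+ c) :- (b :+ d)) refl
    where open +-*-Solver

sum-const : ∀ c n → partialSum (λ _ → c) n ≡ ι n ⊗ c
sum-const c zero    = sym (trans (cong (_⊗ c) ι-0) (ℚ.*-zeroˡ c))
sum-const c (suc n) = begin
  partialSum (λ _ → c) n ⊕ c  ≡⟨ cong (_⊕ c) (sum-const c n) ⟩
  ι n ⊗ c ⊕ c                 ≡⟨ lem (ι n) c ⟩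
  (1ℚ ⊕ ι n) ⊗ c              ≡⟨ cong (λ x → (x ⊕ ι n) ⊗ c) ι-1 ⟨
  (ι 1 ⊕ ι n) ⊗ c             ≡⟨ cong (_⊗ c) (ι-+ 1 n) ⟨
  ι (suc n) ⊗ c               ∎
  where
  open ≡-Reasoning
  lem : ∀ m c → m ⊗ c ⊕ c ≡ (1ℚ ⊕ m) ⊗ c
  lem = solve 2 (λ m c → m :* c :+ c := (con 1ℚ :+ m) :* c) refl
    where open +-*-Solver

sum-swap : ∀ (f : ℕ → ℕ → ℚ) m n →
  partialSum (λ i → partialSum (f i) n) m ≡ partialSum (λ j → partialSum (λ i → f i j) m) n
sum-swap f zero    n = sym (trans (sum-const 0ℚ n) (ℚ.*-zeroʳ (ι n)))
sum-swap f (suc m) n = trans (cong (_⊕ partialSum (f m) n) (sum-swap f m n))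
  (sym (sum-⊕ (λ j → partialSum (λ i → f i j) m) (f m) n))

sum-∣∣ : ∀ (f : ℕ → ℚ) n → ∣ partialSum f n ∣ ⩽ partialSum (λ i → ∣ f i ∣) n
sum-∣∣ f zero    = ℚ.≤-refl
sum-∣∣ f (suc n) = ℚ.≤-trans (ℚ.∣p+q∣≤∣p∣+∣q∣ (partialSum f n) (f n)) (ℚ.+-monoˡ-≤ ∣ f n ∣ (sum-∣∣ f n))

sum-head : ∀ (f : ℕ → ℚ) n → partialSum f (suc n) ≡ f 0 ⊕ partialSum (λ i → f (suc i)) n
sum-head f zero    = trans (ℚ.+-identityˡ (f 0)) (sym (ℚ.+-identityʳ (f 0)))
sum-head f (suc n) = trans (cong (_⊕ f (suc n)) (sum-head f n))
  (ℚ.+-assoc (f 0) (partialSum (λ i → f (suc i)) n) (f (suc n)))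

term≤sum : ∀ {f : ℕ → ℚ} {m n} → (∀ i → 0ℚ ⩽ f i) → m < n → f m ⩽ partialSum f n
term≤sum {f} {m} {suc n} 0≤f (s≤s m≤n) with ℕ.m≤n⇒m<n∨m≡n m≤n
... | inj₁ m<n  = ℚ.≤-trans (term≤sum 0≤f m<n) (p≤p⊕q (0≤f n))
... | inj₂ refl = subst (_⩽ partialSum f n ⊕ f n) (ℚ.+-identityˡ (f n)) (ℚ.+-monoˡ-≤ (f n) (sum-nonNeg n 0≤f))

IsInteger-sum : ∀ {f : ℕ → ℚ} n → (∀ i → i < n → IsInteger (f i)) → IsInteger (partialSum f n)
IsInteger-sum zero    h = + 0 , refl
IsInteger-sum (suc n) h = IsInteger-⊕ (IsInteger-sum n (λ i i<n → h i (ℕ.m<n⇒m<1+n i<n))) (h n ℕ.≤-refl)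

-- Polynomials with integer coefficients

ι-injective : ∀ {m n} → ι m ≡ ι n → m ≡ n
ι-injective {m} {n} eq with ℕ.<-cmp m n
... | tri≈ _ m≡n _ = m≡n
... | tri< m<n _ _ = contradiction eq (ℚ.<⇒≢ (ι-mono-< m<n))
... | tri> _ _ n<m = contradiction (sym eq) (ℚ.<⇒≢ (ι-mono-< n<m))

IsInteger-∣∣ : ∀ {p} → IsInteger p → p ≢ 0ℚ → 1ℚ ⩽ ∣ p ∣
IsInteger-∣∣ {p} P p≢0 with ℚ.<-cmp 0ℚ p
... | tri< 0<p _ _ = ℚ.≤-trans (IsInteger-pos P 0<p) (p≤∣p∣ p)
... | tri≈ _ 0≡p _ = contradiction (sym 0≡p) p≢0
... | tri> _ _ p<0 = ℚ.≤-trans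
  (IsInteger-pos (IsInteger-⊖ (+ 0 , refl) P) (subst (0ℚ ⋖_) (sym (ℚ.+-identityˡ (ℚ.- p))) (ℚ.neg-antimono-< p<0)))
  (ℚ.≤-trans (p≤∣p∣ (0ℚ ⊖ p)) (ℚ.≤-reflexive (trans (cong ∣_∣ (ℚ.+-identityˡ (ℚ.- p))) (ℚ.∣-p∣≡∣p∣ p))))

poly : (ℕ → ℚ) → ℕ → ℚ → ℚ
poly c D x = partialSum (λ j → c j ⊗ x ↑ j) D

poly-head : ∀ c D x → poly c (suc D) x ≡ c 0 ⊕ x ⊗ poly (λ j → c (suc j)) D x
poly-head c D x = trans (sum-head (λ j → c j ⊗ x ↑ j) D)
  (cong₂ _⊕_ (ℚ.*-identityʳ (c 0))
    (trans (sum-cong D (λ j → lem (c (suc j)) x (x ↑ j))) (sum-⊗ˡ x (λ j → c (suc j) ⊗ x ↑ j) D)))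
  where
  lem : ∀ c x y → c ⊗ (x ⊗ y) ≡ x ⊗ (c ⊗ y)
  lem = solve 3 (λ c x y → c :* (x :* y) := x :* (c :* y)) refl
    where open +-*-Solver

poly-⊖ : ∀ c d D x → poly (λ j → c j ⊖ d j) D x ≡ poly c D x ⊖ poly d D x
poly-⊖ c d D x = trans (sum-cong D (λ j → lem (c j) (d j) (x ↑ j))) (sum-⊖ (λ j → c j ⊗ x ↑ j) (λ j → d j ⊗ x ↑ j) D)
  where
  lem : ∀ c d y → (c ⊖ d) ⊗ y ≡ c ⊗ y ⊖ d ⊗ y
  lem = solve 3 (λ c d y → (c :- d) :* y := c :* y :- d :* y) refl
    where open +-*-Solver

∣poly∣≤ : ∀ {c g} D {x} t → 0ℚ ⩽ x → (∀ j → j < D → ∣ c j ∣ ⊗ x ↑ j ⩽ g ⊗ t) → ∣ poly c D x ∣ ⩽ ι D ⊗ (g ⊗ t)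
∣poly∣≤ {c} {g} D {x} t 0≤x h = begin
  ∣ poly c D x ∣                         ≤⟨ sum-∣∣ (λ j → c j ⊗ x ↑ j) D ⟩
  partialSum (λ j → ∣ c j ⊗ x ↑ j ∣) D   ≡⟨ sum-cong D (λ j → ∣∣-⊗ (c j) (↑-nonNeg j 0≤x)) ⟩
  partialSum (λ j → ∣ c j ∣ ⊗ x ↑ j) D   ≤⟨ sum-mono D h ⟩
  partialSum (λ _ → g ⊗ t) D             ≡⟨ sum-const (g ⊗ t) D ⟩
  ι D ⊗ (g ⊗ t)                          ∎
  where open ℚ.≤-Reasoning

-- The lowest nonzero coefficient dominates at a small point: it is at least 1 in absolute value,
-- while the later terms add up to at most ½. Each vanishing coefficient before it costs a factor x,
-- at most x^D in total.
poly-apart : ∀ D {c g x} → 0ℚ ⩽ x → x ⩽ 1ℚ → 0ℚ ⩽ g → (∀ j → IsInteger (c j)) → (∀ j → j < D → ∣ c j ∣ ⩽ g) →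
             x ⊗ (ι D ⊗ g) ⩽ ½ → ∃[ j ] (j < D × c j ≢ 0ℚ) → ½ ⊗ x ↑ D ⩽ ∣ poly c D x ∣
poly-apart (suc D) {c} {g} {x} 0≤x x≤1 0≤g int c≤g small nz with c 0 ℚ.≟ 0ℚ
... | yes c₀≡0 = begin
  ½ ⊗ (x ⊗ x ↑ D)          ≡⟨ swap ½ x (x ↑ D) ⟩
  x ⊗ (½ ⊗ x ↑ D)          ≤⟨ ⊗-monoʳ 0≤x (poly-apart D 0≤x x≤1 0≤g (λ j → int (suc j)) (λ j j<D → c≤g (suc j) (s≤s j<D)) small′ (shift nz)) ⟩
  x ⊗ ∣ poly c′ D x ∣      ≡⟨ ℚ.*-comm x _ ⟩
  ∣ poly c′ D x ∣ ⊗ x      ≡⟨ ∣∣-⊗ (poly c′ D x) 0≤x ⟨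
  ∣ poly c′ D x ⊗ x ∣      ≡⟨ cong ∣_∣ (trans (ℚ.*-comm (poly c′ D x) x) (sym (ℚ.+-identityˡ _))) ⟩
  ∣ 0ℚ ⊕ x ⊗ poly c′ D x ∣ ≡⟨ cong (λ y → ∣ y ⊕ x ⊗ poly c′ D x ∣) c₀≡0 ⟨
  ∣ c 0 ⊕ x ⊗ poly c′ D x ∣ ≡⟨ cong ∣_∣ (poly-head c D x) ⟨
  ∣ poly c (suc D) x ∣     ∎
  where
  open ℚ.≤-Reasoning
  c′ = λ j → c (suc j)
  swap : ∀ a b c → a ⊗ (b ⊗ c) ≡ b ⊗ (a ⊗ c)
  swap = solve 3 (λ a b c → a :* (b :* c) := b :* (a :* c)) refl
    where open +-*-Solver
  small′ : x ⊗ (ι D ⊗ g) ⩽ ½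
  small′ = ℚ.≤-trans (⊗-monoʳ 0≤x (⊗-monoˡ 0≤g (ι-mono-≤ (ℕ.n≤1+n D)))) small
  shift : ∃[ j ] (j < suc D × c j ≢ 0ℚ) → ∃[ j ] (j < D × c (suc j) ≢ 0ℚ)
  shift (zero  , _       , c₀≢0) = contradiction c₀≡0 c₀≢0
  shift (suc j , s≤s j<D , cⱼ≢0) = j , j<D , cⱼ≢0
... | no c₀≢0 = ℚ.≤-trans
  (ℚ.≤-trans (⊗-monoʳ (ℚ.nonNegative⁻¹ ½) (↑≤1 (suc D) 0≤x x≤1)) (ℚ.≤-reflexive (ℚ.*-identityʳ ½)))
  (⊕-cancelʳ-≤ (begin
    ½ ⊕ ½                              ≤⟨ IsInteger-∣∣ (int 0) c₀≢0 ⟩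
    ∣ c 0 ∣                            ≡⟨ cong ∣_∣ (⊕-⊖-cancel (c 0) y) ⟨
    ∣ (c 0 ⊕ y) ⊖ y ∣                  ≤⟨ ℚ.∣p-q∣≤∣p∣+∣q∣ (c 0 ⊕ y) y ⟩
    ∣ c 0 ⊕ y ∣ ⊕ ∣ y ∣                ≤⟨ ℚ.+-monoʳ-≤ ∣ c 0 ⊕ y ∣ y≤½ ⟩
    ∣ c 0 ⊕ y ∣ ⊕ ½                    ≡⟨ cong (λ z → ∣ z ∣ ⊕ ½) (poly-head c D x) ⟨
    ∣ poly c (suc D) x ∣ ⊕ ½           ∎))
  where
  open ℚ.≤-Reasoning
  c′ = λ j → c (suc j)
  y = x ⊗ poly c′ D x
  term : ∀ j → j < D → ∣ c′ j ∣ ⊗ x ↑ j ⩽ g ⊗ 1ℚ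
  term j j<D = ⊗-mono (ℚ.0≤∣p∣ (c′ j)) 0≤1 (c≤g (suc j) (s≤s j<D)) (↑≤1 j 0≤x x≤1)
  y≤½ : ∣ y ∣ ⩽ ½
  y≤½ = begin
    ∣ x ⊗ poly c′ D x ∣        ≡⟨ trans (ℚ.∣p*q∣≡∣p∣*∣q∣ x _) (cong (_⊗ ∣ poly c′ D x ∣) (ℚ.0≤p⇒∣p∣≡p 0≤x)) ⟩
    x ⊗ ∣ poly c′ D x ∣        ≤⟨ ⊗-monoʳ 0≤x (∣poly∣≤ {c′} {g} D 1ℚ 0≤x term) ⟩
    x ⊗ (ι D ⊗ (g ⊗ 1ℚ))       ≡⟨ cong (λ z → x ⊗ (ι D ⊗ z)) (ℚ.*-identityʳ g) ⟩
    x ⊗ (ι D ⊗ g)              ≤⟨ ⊗-monoʳ 0≤x (⊗-monoˡ 0≤g (ι-mono-≤ (ℕ.n≤1+n D))) ⟩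
    x ⊗ (ι (suc D) ⊗ g)        ≤⟨ small ⟩
    ½                          ∎

-- Quadratic forms in the moments

-- A truncation of u^s ζ(s), for u in the role of 1/π.
moment : ℚ → ℕ → ℕ → ℚ
moment u s = partialSum (λ n → (u ⊗ rec n) ↑ s)

form : (ℕ → ℕ → ℚ) → (ℕ → ℚ) → ℕ → ℚ
form a c D = partialSum (λ i → partialSum (λ j → (c i ⊗ c j) ⊗ a i j) D) D

form-⊗ : ∀ q a c D → form (λ i j → q ⊗ a i j) c D ≡ q ⊗ form a c D
form-⊗ q a c D = trans
  (sum-cong D (λ i → trans (sum-cong D (λ j → lem q (c i ⊗ c j) (a i j))) (sum-⊗ˡ q (λ j → (c i ⊗ c j) ⊗ a i j) D)))
  (sum-⊗ˡ q (λ i → partialSum (λ j → (c i ⊗ c j) ⊗ a i j) D) D)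
  where
  lem : ∀ q c a → c ⊗ (q ⊗ a) ≡ q ⊗ (c ⊗ a)
  lem = solve 3 (λ q c a → c :* (q :* a) := q :* (c :* a)) refl
    where open +-*-Solver

poly² : ∀ c D x → poly c D x ⊗ poly c D x ≡ partialSum (λ i → partialSum (λ j → (c i ⊗ c j) ⊗ x ↑ (i + j)) D) D
poly² c D x = begin
  poly c D x ⊗ poly c D x                                               ≡⟨ sum-⊗ʳ (poly c D x) (λ i → c i ⊗ x ↑ i) D ⟨
  partialSum (λ i → (c i ⊗ x ↑ i) ⊗ poly c D x) D                       ≡⟨ sum-cong D (λ i → sum-⊗ˡ (c i ⊗ x ↑ i) (λ j → c j ⊗ x ↑ j) D) ⟨
  partialSum (λ i → partialSum (λ j → (c i ⊗ x ↑ i) ⊗ (c j ⊗ x ↑ j)) D) D ≡⟨ sum-cong D (λ i → sum-cong D (λ j →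
      trans (lem (c i) (x ↑ i) (c j) (x ↑ j)) (cong ((c i ⊗ c j) ⊗_) (sym (↑-+ x i j))))) ⟩
  partialSum (λ i → partialSum (λ j → (c i ⊗ c j) ⊗ x ↑ (i + j)) D) D   ∎
  where
  open ≡-Reasoning
  lem : ∀ a b c d → (a ⊗ b) ⊗ (c ⊗ d) ≡ (a ⊗ c) ⊗ (b ⊗ d)
  lem = solve 4 (λ a b c d → (a :* b) :* (c :* d) := (a :* c) :* (b :* d)) refl
    where open +-*-Solver

-- The sum over the nodes is pulled outside; at each node the double sum over coefficients is the
-- square of the polynomial. Both the upper and the lower bound of the form start from this.
form-moment : ∀ u s c D N → form (λ i j → moment u (s + 2 · (i + j)) N) c D ≡
  partialSum (λ n → (u ⊗ rec n) ↑ s ⊗ (poly c D ((u ⊗ rec n) ↑ 2) ⊗ poly c D ((u ⊗ rec n) ↑ 2))) N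
form-moment u s c D N = begin
  form (λ i j → moment u (s + 2 · (i + j)) N) c D
    ≡⟨ sum-cong D (λ i → sum-cong D (λ j → sum-⊗ˡ (c i ⊗ c j) (λ n → w n ↑ (s + 2 · (i + j))) N)) ⟨
  partialSum (λ i → partialSum (λ j → partialSum (λ n → (c i ⊗ c j) ⊗ w n ↑ (s + 2 · (i + j))) N) D) D
    ≡⟨ sum-cong D (λ i → sum-swap (λ j n → (c i ⊗ c j) ⊗ w n ↑ (s + 2 · (i + j))) D N) ⟩
  partialSum (λ i → partialSum (λ n → partialSum (λ j → (c i ⊗ c j) ⊗ w n ↑ (s + 2 · (i + j))) D) N) D
    ≡⟨ sum-swap (λ i n → partialSum (λ j → (c i ⊗ c j) ⊗ w n ↑ (s + 2 · (i + j))) D) D N ⟩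
  partialSum (λ n → partialSum (λ i → partialSum (λ j → (c i ⊗ c j) ⊗ w n ↑ (s + 2 · (i + j))) D) D) N
    ≡⟨ sum-cong N (λ n → trans (sum-cong D (λ i → trans (sum-cong D (λ j → split n i j))
         (sum-⊗ˡ (w n ↑ s) (λ j → (c i ⊗ c j) ⊗ (w n ↑ 2) ↑ (i + j)) D)))
         (sum-⊗ˡ (w n ↑ s) (λ i → partialSum (λ j → (c i ⊗ c j) ⊗ (w n ↑ 2) ↑ (i + j)) D) D)) ⟩
  partialSum (λ n → w n ↑ s ⊗ partialSum (λ i → partialSum (λ j → (c i ⊗ c j) ⊗ (w n ↑ 2) ↑ (i + j)) D) D) N
    ≡⟨ sum-cong N (λ n → cong (w n ↑ s ⊗_) (sym (poly² c D (w n ↑ 2)))) ⟩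
  partialSum (λ n → w n ↑ s ⊗ (poly c D (w n ↑ 2) ⊗ poly c D (w n ↑ 2))) N ∎
  where
  open ≡-Reasoning
  w = λ n → u ⊗ rec n
  lem : ∀ a b c → c ⊗ (a ⊗ b) ≡ a ⊗ (c ⊗ b)
  lem = solve 3 (λ a b c → c :* (a :* b) := a :* (c :* b)) refl
    where open +-*-Solver
  split : ∀ n i j → (c i ⊗ c j) ⊗ w n ↑ (s + 2 · (i + j)) ≡ w n ↑ s ⊗ ((c i ⊗ c j) ⊗ (w n ↑ 2) ↑ (i + j))
  split n i j = trans (cong ((c i ⊗ c j) ⊗_) (trans (↑-+ (w n) s (2 · (i + j))) (cong (w n ↑ s ⊗_) (sym (↑-↑ (w n) 2 (i + j))))))
    (lem (w n ↑ s) ((w n ↑ 2) ↑ (i + j)) (c i ⊗ c j))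

-- Small values from the box principle

-- Picks the largest t ≤ n with Lt < σ, and 0 if there is none. An interior endpoint thus belongs to
-- the lower cell, and 0 to the first.
cell : ℚ → ℚ → ∀ n → Fin (suc n)
cell L σ zero = Fin.zero
cell L σ (suc n) with σ ℚ.≤? L ⊗ ι (suc n)
... | yes _ = Fin.inject₁ (cell L σ n)
... | no  _ = Fin.fromℕ (suc n)

cell-bounds : ∀ L σ n → 0ℚ ⩽ σ → σ ⩽ L ⊗ ι (suc n) →
              L ⊗ ι (toℕ (cell L σ n)) ⩽ σ × σ ⩽ L ⊗ ι (toℕ (cell L σ n)) ⊕ L
cell-bounds L σ n 0≤σ σ≤ with go n σ≤
  where
  go : ∀ n → σ ⩽ L ⊗ ι (suc n) → L ⊗ ι (toℕ (cell L σ n)) ⩽ σ × σ ⩽ L ⊗ ι (suc (toℕ (cell L σ n)))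
  go zero    σ≤ = subst (_⩽ σ) (sym (trans (cong (L ⊗_) ι-0) (ℚ.*-zeroʳ L))) 0≤σ , σ≤
  go (suc n) σ≤ with σ ℚ.≤? L ⊗ ι (suc n)
  ... | yes σ≤′ = subst (λ t → L ⊗ ι t ⩽ σ × σ ⩽ L ⊗ ι (suc t)) (sym (Fin.toℕ-inject₁ (cell L σ n))) (go n σ≤′)
  ... | no  σ≰  = subst (λ t → L ⊗ ι t ⩽ σ × σ ⩽ L ⊗ ι (suc t)) (sym (Fin.toℕ-fromℕ (suc n)))
                    (ℚ.<⇒≤ (ℚ.≰⇒> σ≰) , σ≤)
... | lo , hi = lo , ℚ.≤-trans hi (ℚ.≤-reflexive
        (trans (cong (L ⊗_) (trans (cong ι (ℕ.+-comm 1 t)) (trans (ι-+ t 1) (cong (ι t ⊕_) ι-1)))) (lem L (ι t))))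
  where
  t = toℕ (cell L σ n)
  lem : ∀ l t → l ⊗ (t ⊕ 1ℚ) ≡ l ⊗ t ⊕ l
  lem = solve 2 (λ l t → l :* (t :+ con 1ℚ) := l :* t :+ l) refl
    where open +-*-Solver

same-cell : ∀ {L σ τ} n → 0ℚ ⩽ σ → σ ⩽ L ⊗ ι (suc n) → 0ℚ ⩽ τ → τ ⩽ L ⊗ ι (suc n) →
            cell L σ n ≡ cell L τ n → ∣ σ ⊖ τ ∣ ⩽ L
same-cell {L} {σ} {τ} n 0≤σ σ≤ 0≤τ τ≤ eq = ∣p⊖q∣≤ {σ} {τ} {L}
  (ℚ.≤-trans (proj₂ inσ) (ℚ.+-monoˡ-≤ L (subst (λ c → L ⊗ ι (toℕ c) ⩽ τ) (sym eq) (proj₁ inτ))))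
  (ℚ.≤-trans (proj₂ inτ) (ℚ.+-monoˡ-≤ L (subst (λ c → L ⊗ ι (toℕ c) ⩽ σ) eq (proj₁ inσ))))
  where
  inσ = cell-bounds L σ n 0≤σ σ≤
  inτ = cell-bounds L τ n 0≤τ τ≤

-- A telescoping majorant, and the estimates at the nodes

rec-step : ∀ n → rec n ⊖ rec (suc n) ≡ rec n ⊗ rec (suc n)
rec-step n = begin
  rec n ⊖ rec (suc n)
    ≡⟨ cong₂ _⊖_ (scale (rec n) (suc n)) (scale (rec (suc n)) n) ⟩
  rec n ⊗ (ι (suc (suc n)) ⊗ rec (suc n)) ⊖ rec (suc n) ⊗ (ι (suc n) ⊗ rec n)
    ≡⟨ cong (λ z → rec n ⊗ (z ⊗ rec (suc n)) ⊖ rec (suc n) ⊗ (ι (suc n) ⊗ rec n)) (trans (ι-+ 1 (suc n)) (cong (_⊕ ι (suc n)) ι-1)) ⟩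
  rec n ⊗ ((1ℚ ⊕ ι (suc n)) ⊗ rec (suc n)) ⊖ rec (suc n) ⊗ (ι (suc n) ⊗ rec n)
    ≡⟨ lem (rec n) (rec (suc n)) (ι (suc n)) ⟩
  rec n ⊗ rec (suc n) ∎
  where
  open ≡-Reasoning
  scale : ∀ p n → p ≡ p ⊗ (ι (suc n) ⊗ rec n)
  scale p n = sym (trans (cong (p ⊗_) (ι⊗rec n)) (ℚ.*-identityʳ p))
  lem : ∀ r s i → r ⊗ ((1ℚ ⊕ i) ⊗ s) ⊖ s ⊗ (i ⊗ r) ≡ r ⊗ s
  lem = solve 3 (λ r s i → r :* ((con 1ℚ :+ i) :* s) :- s :* (i :* r) := r :* s) refl
    where open +-*-Solver

sum-rec≤ : ∀ m N → partialSum (λ n → rec (m + n) ⊗ rec (suc (m + n))) N ⩽ rec m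
sum-rec≤ m N = subst (_⩽ rec m) (sym (telescope N))
  (ℚ.≤-trans (ℚ.+-monoʳ-≤ (rec m) (ℚ.neg-antimono-≤ (rec-nonNeg (m + N)))) (ℚ.≤-reflexive (ℚ.+-identityʳ (rec m))))
  where
  telescope : ∀ N → partialSum (λ n → rec (m + n) ⊗ rec (suc (m + n))) N ≡ rec m ⊖ rec (m + N)
  telescope zero    = trans (sym (ℚ.+-inverseʳ (rec m))) (cong (λ z → rec m ⊖ rec z) (sym (ℕ.+-identityʳ m)))
  telescope (suc N) = trans (cong₂ _⊕_ (telescope N) (sym (rec-step (m + N))))
    (trans (lem (rec m) (rec (m + N)) (rec (suc (m + N)))) (cong (λ z → rec m ⊖ rec z) (sym (ℕ.+-suc m N))))
    where
    lem : ∀ a b c → (a ⊖ b) ⊕ (b ⊖ c) ≡ a ⊖ c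
    lem = solve 3 (λ a b c → (a :- b) :+ (b :- c) := a :- c) refl
      where open +-*-Solver

≤rec⊗rec : ∀ {p q} a → p ⊗ ι (suc a · suc (suc a)) ⩽ q → p ⩽ q ⊗ (rec a ⊗ rec (suc a))
≤rec⊗rec {p} {q} a h = subst (_⩽ q ⊗ (rec a ⊗ rec (suc a))) (begin
  p ⊗ ι (suc a · suc (suc a)) ⊗ (rec a ⊗ rec (suc a))            ≡⟨ cong (λ z → p ⊗ z ⊗ (rec a ⊗ rec (suc a))) (ι-· (suc a) (suc (suc a))) ⟩
  p ⊗ (ι (suc a) ⊗ ι (suc (suc a))) ⊗ (rec a ⊗ rec (suc a))      ≡⟨ lem p (ι (suc a)) (ι (suc (suc a))) (rec a) (rec (suc a)) ⟩
  p ⊗ ((ι (suc a) ⊗ rec a) ⊗ (ι (suc (suc a)) ⊗ rec (suc a)))    ≡⟨ cong₂ (λ x y → p ⊗ (x ⊗ y)) (ι⊗rec a) (ι⊗rec (suc a)) ⟩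
  p ⊗ (1ℚ ⊗ 1ℚ)                                                  ≡⟨ ℚ.*-identityʳ p ⟩
  p                                                              ∎)
  (⊗-monoˡ (⊗-nonNeg (rec-nonNeg a) (rec-nonNeg (suc a))) h)
  where
  open ≡-Reasoning
  lem : ∀ p i j r s → p ⊗ (i ⊗ j) ⊗ (r ⊗ s) ≡ p ⊗ ((i ⊗ r) ⊗ (j ⊗ s))
  lem = solve 5 (λ p i j r s → p :* (i :* j) :* (r :* s) := p :* ((i :* r) :* (j :* s))) refl
    where open +-*-Solver

-- Here u stands for 1/π, and y n = 3M·u/(n+1) for the point at node n+1 in the scale of the
-- coefficients; θ n = M/(n+1) bounds it.
module Estimate (m k H : ℕ) {u : ℚ} (0≤u : 0ℚ ⩽ u) (3u≤1 : ι 3 ⊗ u ⩽ 1ℚ) where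

  M b : ℕ
  M = suc m
  b = suc k + 2 · m

  L : ℚ
  L = ι (H · M)

  w θ x : ℕ → ℚ
  w n = u ⊗ rec n
  θ n = ι M ⊗ rec n
  x n = w n ↑ 2

  0≤w : ∀ n → 0ℚ ⩽ w n
  0≤w n = ⊗-nonNeg 0≤u (rec-nonNeg n)

  0≤x : ∀ n → 0ℚ ⩽ x n
  0≤x n = ↑-nonNeg 2 (0≤w n)

  0≤θ : ∀ n → 0ℚ ⩽ θ n
  0≤θ n = ⊗-nonNeg (ι-nonNeg M) (rec-nonNeg n)

  0≤L : 0ℚ ⩽ L
  0≤L = ι-nonNeg (H · M)

  y : ℕ → ℚ
  y n = ι (3 · M) ⊗ w n

  0≤y : ∀ n → 0ℚ ⩽ y n
  0≤y n = ⊗-nonNeg (ι-nonNeg (3 · M)) (0≤w n)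

  y≤θ : ∀ n → y n ⩽ θ n
  y≤θ n = begin
    ι (3 · M) ⊗ (u ⊗ rec n)       ≡⟨ cong (_⊗ (u ⊗ rec n)) (ι-· 3 M) ⟩
    (ι 3 ⊗ ι M) ⊗ (u ⊗ rec n)     ≡⟨ lem (ι 3) (ι M) u (rec n) ⟩
    (ι 3 ⊗ u) ⊗ (ι M ⊗ rec n)     ≤⟨ ⊗-monoˡ (0≤θ n) 3u≤1 ⟩
    1ℚ ⊗ (ι M ⊗ rec n)            ≡⟨ ℚ.*-identityˡ (θ n) ⟩
    θ n                           ∎
    where
    open ℚ.≤-Reasoning
    lem : ∀ t m u r → (t ⊗ m) ⊗ (u ⊗ r) ≡ (t ⊗ u) ⊗ (m ⊗ r)
    lem = solve 4 (λ t m u r → (t :* m) :* (u :* r) := (t :* u) :* (m :* r)) refl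
      where open +-*-Solver

  θ≤1 : ∀ {n} → M ≤ suc n → θ n ⩽ 1ℚ
  θ≤1 {n} h = subst (θ n ⩽_) (ι⊗rec n) (⊗-monoˡ (rec-nonNeg n) (ι-mono-≤ h))

  1≤θ : ∀ {n} → suc n ≤ M → 1ℚ ⩽ θ n
  1≤θ {n} h = subst (_⩽ θ n) (ι⊗rec n) (⊗-monoˡ (rec-nonNeg n) (ι-mono-≤ h))

  θ↑⊗ι : ∀ n e → θ n ↑ e ⊗ ι (suc n ^ⁿ e) ≡ ι (M ^ⁿ e)
  θ↑⊗ι n e = begin
    θ n ↑ e ⊗ ι (suc n ^ⁿ e)          ≡⟨ cong (θ n ↑ e ⊗_) (ι-^ (suc n) e) ⟩
    θ n ↑ e ⊗ ι (suc n) ↑ e           ≡⟨ ↑-⊗ (θ n) (ι (suc n)) e ⟨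
    (θ n ⊗ ι (suc n)) ↑ e             ≡⟨ cong (_↑ e) (trans (ℚ.*-assoc (ι M) (rec n) (ι (suc n))) (cong (ι M ⊗_) (trans (ℚ.*-comm (rec n) (ι (suc n))) (ι⊗rec n)))) ⟩
    (ι M ⊗ 1ℚ) ↑ e                    ≡⟨ cong (_↑ e) (ℚ.*-identityʳ (ι M)) ⟩
    ι M ↑ e                           ≡⟨ ι-^ M e ⟨
    ι (M ^ⁿ e)                        ∎
    where open ≡-Reasoning

  θ↑b≤boxes : ∀ n → θ n ↑ b ⩽ ι (boxes M b n)
  θ↑b≤boxes n = ⊗-cancelˡ-≤ (ℚ.<-≤-trans 0<1 (1≤ι (ℕ.m^n>0 (suc n) b))) (begin
    ι (suc n ^ⁿ b) ⊗ θ n ↑ b           ≡⟨ ℚ.*-comm (ι (suc n ^ⁿ b)) (θ n ↑ b) ⟩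
    θ n ↑ b ⊗ ι (suc n ^ⁿ b)           ≡⟨ θ↑⊗ι n b ⟩
    ι (M ^ⁿ b)                         ≤⟨ ι-mono-≤ (ℕ.<⇒≤ (^<boxes M b n)) ⟩
    ι (boxes M b n · suc n ^ⁿ b)       ≡⟨ trans (ι-· (boxes M b n) (suc n ^ⁿ b)) (ℚ.*-comm (ι (boxes M b n)) _) ⟩
    ι (suc n ^ⁿ b) ⊗ ι (boxes M b n)   ∎)
    where open ℚ.≤-Reasoning

  Bounded : (ℕ → ℚ) → Set
  Bounded c = ∀ j → ∣ c j ∣ ⩽ ι (coeffBound H M j)

  -- The factor (3M)^(2j) of the coefficient bound turns x^j into y^(2j), and y ≤ θ. There are M
  -- terms of size at most Ht, hence L = HM.
  ∣poly∣≤L : ∀ {c} n t → Bounded c → (∀ j → j < M → θ n ↑ (2 · j) ⩽ t) → ∣ poly c M (x n) ∣ ⩽ L ⊗ t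
  ∣poly∣≤L {c} n t c≤ h = ℚ.≤-trans (∣poly∣≤ {c} {ι H} M t (0≤x n) term)
    (ℚ.≤-reflexive (trans (lem (ι M) (ι H) t) (cong (_⊗ t) (sym (ι-· H M)))))
    where
    open ℚ.≤-Reasoning
    lem : ∀ m h t → m ⊗ (h ⊗ t) ≡ (h ⊗ m) ⊗ t
    lem = solve 3 (λ m h t → m :* (h :* t) := (h :* m) :* t) refl
      where open +-*-Solver
    term : ∀ j → j < M → ∣ c j ∣ ⊗ x n ↑ j ⩽ ι H ⊗ t
    term j j<M = begin
      ∣ c j ∣ ⊗ x n ↑ j                              ≤⟨ ⊗-monoˡ (↑-nonNeg j (0≤x n)) (c≤ j) ⟩
      ι (coeffBound H M j) ⊗ x n ↑ j                 ≡⟨ cong₂ _⊗_ (trans (ι-· H _) (cong (ι H ⊗_) (ι-^ (3 · M) (2 · j)))) (↑-↑ (w n) 2 j) ⟩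
      (ι H ⊗ ι (3 · M) ↑ (2 · j)) ⊗ w n ↑ (2 · j)    ≡⟨ ℚ.*-assoc (ι H) _ _ ⟩
      ι H ⊗ (ι (3 · M) ↑ (2 · j) ⊗ w n ↑ (2 · j))    ≡⟨ cong (ι H ⊗_) (↑-⊗ (ι (3 · M)) (w n) (2 · j)) ⟨
      ι H ⊗ y n ↑ (2 · j)                            ≤⟨ ⊗-monoʳ (ι-nonNeg H) (ℚ.≤-trans (↑-mono (2 · j) (0≤y n) (y≤θ n)) (h j j<M)) ⟩
      ι H ⊗ t                                        ∎

  far : ∀ {c n} → Bounded c → M ≤ suc n → ∣ poly c M (x n) ∣ ⩽ L
  far {c} {n} c≤ h = subst (∣ poly c M (x n) ∣ ⩽_) (ℚ.*-identityʳ L)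
    (∣poly∣≤L {c} n 1ℚ c≤ (λ j _ → ↑≤1 (2 · j) (0≤θ n) (θ≤1 h)))

  -- With θ ≥ 1 the top power θ^(2m) bounds all the others; times θ^(k+1) it gives θ^b, the exponent
  -- for which the boxes are counted.
  near : ∀ {c n} → Bounded c → suc n ≤ M → ∣ poly c M (x n) ∣ ⊗ θ n ↑ suc k ⩽ L ⊗ ι (boxes M b n)
  near {c} {n} c≤ h = begin
    ∣ poly c M (x n) ∣ ⊗ θ n ↑ suc k        ≤⟨ ⊗-monoˡ (↑-nonNeg (suc k) (0≤θ n)) (∣poly∣≤L {c} n (θ n ↑ (2 · m)) c≤
                                                 (λ { j (s≤s j≤m) → ↑-mono-exp (1≤θ h) (ℕ.≤⇒≤′ (ℕ.*-monoʳ-≤ 2 j≤m)) })) ⟩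
    L ⊗ θ n ↑ (2 · m) ⊗ θ n ↑ suc k         ≡⟨ trans (ℚ.*-assoc L _ _) (cong (L ⊗_) (ℚ.*-comm (θ n ↑ (2 · m)) (θ n ↑ suc k))) ⟩
    L ⊗ (θ n ↑ suc k ⊗ θ n ↑ (2 · m))       ≡⟨ cong (L ⊗_) (↑-+ (θ n) (suc k) (2 · m)) ⟨
    L ⊗ θ n ↑ b                             ≤⟨ ⊗-monoʳ 0≤L (θ↑b≤boxes n) ⟩
    L ⊗ ι (boxes M b n)                     ∎
    where open ℚ.≤-Reasoning

  -- The weight of C² at a node is of size θ^(2k+1) after scaling. Each factor C receives half of
  -- it, rounded up to θ^(k+1), before the cells are cut.
  value : (ℕ → ℕ) → ℕ → ℚ
  value c n = poly (λ j → ι (c j)) M (x n) ⊗ θ n ↑ suc k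

  0≤poly : ∀ (c : ℕ → ℕ) n → 0ℚ ⩽ poly (λ j → ι (c j)) M (x n)
  0≤poly c n = sum-nonNeg M (λ j → ⊗-nonNeg (ι-nonNeg (c j)) (↑-nonNeg j (0≤x n)))

  0≤value : ∀ (c : ℕ → ℕ) n → 0ℚ ⩽ value c n
  0≤value c n = ⊗-nonNeg (0≤poly c n) (↑-nonNeg (suc k) (0≤θ n))

  value≤ : ∀ {c : ℕ → ℕ} {n} → (∀ j → c j ≤ coeffBound H M j) → suc n ≤ M → value c n ⩽ L ⊗ ι (boxes M b n)
  value≤ {c} {n} c≤ h = subst (λ p → p ⊗ θ n ↑ suc k ⩽ L ⊗ ι (boxes M b n)) (ℚ.0≤p⇒∣p∣≡p (0≤poly c n))
    (near {λ j → ι (c j)} (λ j → ℚ.≤-trans (ℚ.≤-reflexive (ℚ.0≤p⇒∣p∣≡p (ι-nonNeg (c j)))) (ι-mono-≤ (c≤ j))) h)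

  record Small (c : ℕ → ℚ) : Set where
    field
      integral : ∀ j → IsInteger (c j)
      bounded  : Bounded c
      nonzero  : ∃[ j ] (j < M × c j ≢ 0ℚ)
      -- The node ν = M, which is n = m, gets no boxes: there θ = 1, and `far` already gives the
      -- bound L.
      close    : ∀ n → n < m → ∣ poly c M (x n) ∣ ⊗ θ n ↑ suc k ⩽ L

  -- C is the difference of two polynomials with natural coefficients that share all cells. Both
  -- coefficients lie between 0 and `coeffBound`, so their difference obeys the same bound in
  -- absolute value.
  small-polynomial : ∏ (boxes M b) m < ∏ (λ j → suc (coeffBound H M j)) M → ∃[ c ] Small c
  small-polynomial crowded with box-principle {D = M} crowded (λ c _ n → cell L (value c n) (lastBox M b n))
  ... | c , d , c≤ , d≤ , (j , j<M , cⱼ≢dⱼ) , same = (λ i → ι (c i) ⊖ ι (d i)) , record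
    { integral = λ i → IsInteger-⊖ (IsInteger-ι (c i)) (IsInteger-ι (d i))
    ; bounded  = λ i → ∣p⊖q∣≤ {ι (c i)} {ι (d i)} (difference (c i) (d i) (c≤ i)) (difference (d i) (c i) (d≤ i))
    ; nonzero  = j , j<M , λ eq → cⱼ≢dⱼ (ι-injective (p⊖q≡0⇒p≡q {ι (c j)} {ι (d j)} eq))
    ; close    = λ n n<m → subst (_⩽ L) (split n)
        (same-cell {L} {value c n} {value d n} (lastBox M b n) (0≤value c n) (value≤ {c} c≤ (ℕ.m<n⇒m<1+n n<m)) (0≤value d n) (value≤ {d} d≤ (ℕ.m<n⇒m<1+n n<m)) (same n n<m))
    }
    where
    difference : ∀ p q {g} → p ≤ g → ι p ⩽ ι q ⊕ ι g
    difference p q {g} p≤g = ℚ.≤-trans (ι-mono-≤ (ℕ.≤-trans p≤g (ℕ.m≤n+m g q))) (ℚ.≤-reflexive (ι-+ q g))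
    p⊖q≡0⇒p≡q : ∀ {p q} → p ⊖ q ≡ 0ℚ → p ≡ q
    p⊖q≡0⇒p≡q {p} {q} eq = trans (sym (⊖-⊕-cancel p q)) (trans (cong (_⊕ q) eq) (ℚ.+-identityˡ q))
    split : ∀ n → ∣ value c n ⊖ value d n ∣ ≡ ∣ poly (λ i → ι (c i) ⊖ ι (d i)) M (x n) ∣ ⊗ θ n ↑ suc k
    split n = trans (cong ∣_∣ (lem (poly (λ i → ι (c i)) M (x n)) (poly (λ i → ι (d i)) M (x n)) (θ n ↑ suc k)))
      (trans (∣∣-⊗ (poly (λ i → ι (c i)) M (x n) ⊖ poly (λ i → ι (d i)) M (x n)) (↑-nonNeg (suc k) (0≤θ n)))
        (cong (λ p → ∣ p ∣ ⊗ θ n ↑ suc k) (sym (poly-⊖ (λ i → ι (c i)) (λ i → ι (d i)) M (x n)))))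
      where
      lem : ∀ p q t → p ⊗ t ⊖ q ⊗ t ≡ (p ⊖ q) ⊗ t
      lem = solve 3 (λ p q t → p :* t :- q :* t := (p :- q) :* t) refl
        where open +-*-Solver


  weight : (ℕ → ℚ) → ℕ → ℚ
  weight c n = w n ↑ suc (2 · k) ⊗ (poly c M (x n) ⊗ poly c M (x n))

  module _ (1≤k : 1 ≤ k) {c : ℕ → ℚ} (small : Small c) where
    open Small small

    private
      P : ℕ → ℚ
      P n = ∣ poly c M (x n) ∣

      0≤P : ∀ n → 0ℚ ⩽ P n
      0≤P n = ℚ.0≤∣p∣ (poly c M (x n))

    scaled-weight≤ : ∀ n → ι (3 · M) ↑ suc (2 · k) ⊗ weight c n ⩽ θ n ↑ suc (2 · k) ⊗ (P n ⊗ P n)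
    scaled-weight≤ n = begin
      ι (3 · M) ↑ s ⊗ (w n ↑ s ⊗ (p ⊗ p)) ≡⟨ cong (λ z → ι (3 · M) ↑ s ⊗ (w n ↑ s ⊗ z)) (square≡∣∣² p) ⟩
      ι (3 · M) ↑ s ⊗ (w n ↑ s ⊗ (P n ⊗ P n)) ≡⟨ ℚ.*-assoc (ι (3 · M) ↑ s) (w n ↑ s) (P n ⊗ P n) ⟨
      ι (3 · M) ↑ s ⊗ w n ↑ s ⊗ (P n ⊗ P n)   ≡⟨ cong (_⊗ (P n ⊗ P n)) (↑-⊗ (ι (3 · M)) (w n) s) ⟨
      y n ↑ s ⊗ (P n ⊗ P n)                   ≤⟨ ⊗-monoˡ (⊗-nonNeg (0≤P n) (0≤P n)) (↑-mono s (0≤y n) (y≤θ n)) ⟩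
      θ n ↑ s ⊗ (P n ⊗ P n)                   ∎
      where
      open ℚ.≤-Reasoning
      s = suc (2 · k)
      p = poly c M (x n)

    scaled-weight-near : ∀ {n} → n < m → ι (3 · M) ↑ suc (2 · k) ⊗ weight c n ⩽ L ⊗ L
    scaled-weight-near {n} n<m = begin
      ι (3 · M) ↑ suc (2 · k) ⊗ weight c n          ≤⟨ scaled-weight≤ n ⟩
      -- As θ ≥ 1, the odd exponent 2k+1 may be raised to 2(k+1), which splits evenly between the
      -- two factors.
      θ n ↑ suc (2 · k) ⊗ (P n ⊗ P n)               ≤⟨ ⊗-monoˡ (⊗-nonNeg (0≤P n) (0≤P n)) (↑-mono-exp (1≤θ (ℕ.m<n⇒m<1+n n<m)) (ℕ.≤⇒≤′ (exponent k))) ⟩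
      θ n ↑ (suc k + suc k) ⊗ (P n ⊗ P n)           ≡⟨ cong (_⊗ (P n ⊗ P n)) (↑-+ (θ n) (suc k) (suc k)) ⟩
      (θ n ↑ suc k ⊗ θ n ↑ suc k) ⊗ (P n ⊗ P n)     ≡⟨ lem (θ n ↑ suc k) (P n) ⟩
      (P n ⊗ θ n ↑ suc k) ⊗ (P n ⊗ θ n ↑ suc k)     ≤⟨ ⊗-mono 0≤Pθ 0≤L (close n n<m) (close n n<m) ⟩
      L ⊗ L                                         ∎
      where
      open ℚ.≤-Reasoning
      0≤Pθ : 0ℚ ⩽ P n ⊗ θ n ↑ suc k
      0≤Pθ = ⊗-nonNeg (0≤P n) (↑-nonNeg (suc k) (0≤θ n))
      exponent : ∀ k → suc (2 · k) ≤ suc k + suc k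
      exponent k = s≤s (ℕ.+-monoʳ-≤ k (ℕ.≤-trans (ℕ.≤-reflexive (ℕ.+-identityʳ k)) (ℕ.n≤1+n k)))
      lem : ∀ t p → (t ⊗ t) ⊗ (p ⊗ p) ≡ (p ⊗ t) ⊗ (p ⊗ t)
      lem = solve 2 (λ t p → (t :* t) :* (p :* p) := (p :* t) :* (p :* t)) refl
        where open +-*-Solver

    scaled-weight-far : ∀ {n} → M ≤ suc n → ι (3 · M) ↑ suc (2 · k) ⊗ weight c n ⩽ θ n ↑ 2 ⊗ (L ⊗ L)
    scaled-weight-far {n} M≤1+n = ℚ.≤-trans (scaled-weight≤ n)
      (⊗-mono (↑-nonNeg (suc (2 · k)) (0≤θ n)) (⊗-nonNeg 0≤L 0≤L)
        -- As θ ≤ 1, the exponent may be lowered to 2, which is still enough for a summable tail.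
        (↑-antimono-exp (0≤θ n) (θ≤1 M≤1+n) (ℕ.≤⇒≤′ (s≤s (ℕ.*-mono-≤ {1} {2} {1} (s≤s z≤n) 1≤k))))
        (⊗-mono (0≤P n) 0≤L (far {c} bounded M≤1+n) (far {c} bounded M≤1+n)))

    -- One majorant serves both ranges, because (m+n+1)(m+n+2) ≤ 4d² for d the larger of M and n+1.
    -- Near nodes have d = M; at far nodes the factor θ² = M²/(n+1)² cancels d².
    scaled-weight-decay : ∀ n → ι (3 · M) ↑ suc (2 · k) ⊗ weight c n ⩽
      (L ⊗ L ⊗ ι (4 · (M · M))) ⊗ (rec (m + n) ⊗ rec (suc (m + n)))
    scaled-weight-decay n = ≤rec⊗rec (m + n) (cases (n ℕ.<? m))
      where
      open ℚ.≤-Reasoning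
      K : ℕ
      K = suc (m + n) · suc (suc (m + n))
      lem : ∀ t l k → (t ⊗ l) ⊗ k ≡ l ⊗ (t ⊗ k)
      lem = solve 3 (λ t l k → (t :* l) :* k := l :* (t :* k)) refl
        where open +-*-Solver
      K≤ : ∀ {d} → M ≤ d → suc n ≤ d → K ≤ 4 · (d · d)
      K≤ {d} M≤d n<d = ℕ.≤-trans (ℕ.*-mono-≤ (ℕ.≤-trans (ℕ.n≤1+n _) 2+m+n≤2d) 2+m+n≤2d) (ℕ.≤-reflexive (eq d))
        where
        2+m+n≤2d : suc (suc (m + n)) ≤ d + d
        2+m+n≤2d = subst (_≤ d + d) (cong suc (ℕ.+-suc m n)) (ℕ.+-mono-≤ M≤d n<d)
        eq : ∀ d → (d + d) · (d + d) ≡ 4 · (d · d)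
        eq = solve-∀
      cases : Dec (n < m) → ι (3 · M) ↑ suc (2 · k) ⊗ weight c n ⊗ ι K ⩽ L ⊗ L ⊗ ι (4 · (M · M))
      cases (yes n<m) = ⊗-mono
        (⊗-nonNeg (↑-nonNeg (suc (2 · k)) (ι-nonNeg (3 · M)))
          (⊗-nonNeg (↑-nonNeg (suc (2 · k)) (0≤w n)) (subst (0ℚ ⩽_) (sym (square≡∣∣² (poly c M (x n)))) (⊗-nonNeg (0≤P n) (0≤P n)))))
        (ι-nonNeg (4 · (M · M))) (scaled-weight-near n<m) (ι-mono-≤ (K≤ ℕ.≤-refl (ℕ.m<n⇒m<1+n n<m)))
      cases (no n≮m) = begin
        ι (3 · M) ↑ suc (2 · k) ⊗ weight c n ⊗ ι K   ≤⟨ ⊗-monoˡ (ι-nonNeg K) (scaled-weight-far M≤1+n) ⟩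
        (θ n ↑ 2 ⊗ (L ⊗ L)) ⊗ ι K                    ≡⟨ lem (θ n ↑ 2) (L ⊗ L) (ι K) ⟩
        (L ⊗ L) ⊗ (θ n ↑ 2 ⊗ ι K)                    ≤⟨ ⊗-monoʳ (⊗-nonNeg 0≤L 0≤L) (⊗-monoʳ (↑-nonNeg 2 (0≤θ n)) (ι-mono-≤ (K≤ M≤1+n ℕ.≤-refl))) ⟩
        (L ⊗ L) ⊗ (θ n ↑ 2 ⊗ ι (4 · (suc n · suc n))) ≡⟨ cong ((L ⊗ L) ⊗_) θ²K ⟩
        (L ⊗ L) ⊗ ι (4 · (M · M))                    ∎
        where
        M≤1+n : M ≤ suc n
        M≤1+n = s≤s (ℕ.≮⇒≥ n≮m)
        sq : ∀ d → d · d ≡ d ^ⁿ 2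
        sq d = cong (d ·_) (sym (ℕ.*-identityʳ d))
        θ²K : θ n ↑ 2 ⊗ ι (4 · (suc n · suc n)) ≡ ι (4 · (M · M))
        θ²K = begin-equality
          θ n ↑ 2 ⊗ ι (4 · (suc n · suc n))   ≡⟨ cong (λ d → θ n ↑ 2 ⊗ ι (4 · d)) (sq (suc n)) ⟩
          θ n ↑ 2 ⊗ ι (4 · suc n ^ⁿ 2)        ≡⟨ cong (θ n ↑ 2 ⊗_) (ι-· 4 (suc n ^ⁿ 2)) ⟩
          θ n ↑ 2 ⊗ (ι 4 ⊗ ι (suc n ^ⁿ 2))    ≡⟨ swap (θ n ↑ 2) (ι 4) (ι (suc n ^ⁿ 2)) ⟩
          ι 4 ⊗ (θ n ↑ 2 ⊗ ι (suc n ^ⁿ 2))    ≡⟨ cong (ι 4 ⊗_) (θ↑⊗ι n 2) ⟩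
          ι 4 ⊗ ι (M ^ⁿ 2)                    ≡⟨ ι-· 4 (M ^ⁿ 2) ⟨
          ι (4 · M ^ⁿ 2)                      ≡⟨ cong (λ d → ι (4 · d)) (sq M) ⟨
          ι (4 · (M · M))                     ∎
          where
          swap : ∀ a b c → a ⊗ (b ⊗ c) ≡ b ⊗ (a ⊗ c)
          swap = solve 3 (λ a b c → a :* (b :* c) := b :* (a :* c)) refl
            where open +-*-Solver

    -- The majorant telescopes to 4L²M²/M. One factor 3M of (3M)^(2k+1) cancels the surviving M and
    -- leaves the 3, whose slack later pays for the passage to the limit.
    sum-weight≤ : ∀ N → 4 · b ! · (H · M) ^ⁿ 2 ≤ (3 · M) ^ⁿ (2 · k) → ι 3 ⊗ (ι (b !) ⊗ partialSum (weight c) N) ⩽ 1ℚ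
    sum-weight≤ N le = ⊗-cancelˡ-≤ (ℚ.<-≤-trans 0<1 (1≤ι (ℕ.m^n>0 (3 · M) (2 · k)))) (begin
      ι ((3 · M) ^ⁿ (2 · k)) ⊗ (ι 3 ⊗ (ι f ⊗ S))
        ≡⟨ cong (_⊗ (ι 3 ⊗ (ι f ⊗ S))) (ι-^ (3 · M) (2 · k)) ⟩
      T ⊗ (ι 3 ⊗ (ι f ⊗ S))
        ≡⟨ lem₀ T (ι 3) (ι f) S ⟩
      1ℚ ⊗ (ι f ⊗ (ι 3 ⊗ T ⊗ S))
        ≡⟨ cong (_⊗ (ι f ⊗ (ι 3 ⊗ T ⊗ S))) (ι⊗rec m) ⟨
      (ι M ⊗ rec m) ⊗ (ι f ⊗ (ι 3 ⊗ T ⊗ S))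
        ≡⟨ lem₁ (ι M) (rec m) (ι f) (ι 3) T S ⟩
      ι f ⊗ rec m ⊗ ((ι 3 ⊗ ι M) ⊗ T ⊗ S)
        ≡⟨ cong (λ z → ι f ⊗ rec m ⊗ (z ⊗ T ⊗ S)) (ι-· 3 M) ⟨
      ι f ⊗ rec m ⊗ (ι (3 · M) ⊗ T ⊗ S)
        ≤⟨ ⊗-monoʳ (⊗-nonNeg (ι-nonNeg f) (rec-nonNeg m)) total ⟩
      ι f ⊗ rec m ⊗ ((L ⊗ L ⊗ ι (4 · (M · M))) ⊗ rec m)
        ≡⟨ cong (λ z → ι f ⊗ rec m ⊗ ((L ⊗ L ⊗ z) ⊗ rec m)) (trans (ι-· 4 (M · M)) (cong (ι 4 ⊗_) (ι-· M M))) ⟩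
      ι f ⊗ rec m ⊗ ((L ⊗ L ⊗ (ι 4 ⊗ (ι M ⊗ ι M))) ⊗ rec m)
        ≡⟨ lem₂ (ι f) (rec m) L (ι 4) (ι M) ⟩
      (ι 4 ⊗ ι f ⊗ (L ⊗ L)) ⊗ ((ι M ⊗ rec m) ⊗ (ι M ⊗ rec m))
        ≡⟨ cong (λ z → (ι 4 ⊗ ι f ⊗ (L ⊗ L)) ⊗ (z ⊗ z)) (ι⊗rec m) ⟩
      (ι 4 ⊗ ι f ⊗ (L ⊗ L)) ⊗ (1ℚ ⊗ 1ℚ)
        ≡⟨ ℚ.*-identityʳ _ ⟩
      ι 4 ⊗ ι f ⊗ (L ⊗ L)
        ≡⟨ cong₂ _⊗_ (ι-· 4 f) (trans (cong ι (sq (H · M))) (ι-· (H · M) (H · M))) ⟨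
      ι (4 · f) ⊗ ι ((H · M) ^ⁿ 2)
        ≡⟨ ι-· (4 · f) ((H · M) ^ⁿ 2) ⟨
      ι (4 · f · (H · M) ^ⁿ 2)
        ≤⟨ ι-mono-≤ le ⟩
      ι ((3 · M) ^ⁿ (2 · k))
        ≡⟨ ℚ.*-identityʳ _ ⟨
      ι ((3 · M) ^ⁿ (2 · k)) ⊗ 1ℚ ∎)
      where
      open ℚ.≤-Reasoning
      f = b !
      S = partialSum (weight c) N
      T = ι (3 · M) ↑ (2 · k)
      sq : ∀ d → d ^ⁿ 2 ≡ d · d
      sq d = cong (d ·_) (ℕ.*-identityʳ d)
      total : ι (3 · M) ⊗ T ⊗ S ⩽ (L ⊗ L ⊗ ι (4 · (M · M))) ⊗ rec m
      total = begin
        ι (3 · M) ⊗ T ⊗ S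
          ≡⟨ sum-⊗ˡ (ι (3 · M) ↑ suc (2 · k)) (weight c) N ⟨
        partialSum (λ n → ι (3 · M) ↑ suc (2 · k) ⊗ weight c n) N
          ≤⟨ sum-mono N (λ n _ → scaled-weight-decay n) ⟩
        partialSum (λ n → (L ⊗ L ⊗ ι (4 · (M · M))) ⊗ (rec (m + n) ⊗ rec (suc (m + n)))) N
          ≡⟨ sum-⊗ˡ (L ⊗ L ⊗ ι (4 · (M · M))) (λ n → rec (m + n) ⊗ rec (suc (m + n))) N ⟩
        (L ⊗ L ⊗ ι (4 · (M · M))) ⊗ partialSum (λ n → rec (m + n) ⊗ rec (suc (m + n))) N
          ≤⟨ ⊗-monoʳ (⊗-nonNeg (⊗-nonNeg 0≤L 0≤L) (ι-nonNeg (4 · (M · M)))) (sum-rec≤ m N) ⟩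
        (L ⊗ L ⊗ ι (4 · (M · M))) ⊗ rec m ∎
      lem₀ : ∀ t i f s → t ⊗ (i ⊗ (f ⊗ s)) ≡ 1ℚ ⊗ (f ⊗ (i ⊗ t ⊗ s))
      lem₀ = solve 4 (λ t i f s → t :* (i :* (f :* s)) := con 1ℚ :* (f :* (i :* t :* s))) refl
        where open +-*-Solver
      lem₁ : ∀ a r f i t s → (a ⊗ r) ⊗ (f ⊗ (i ⊗ t ⊗ s)) ≡ f ⊗ r ⊗ ((i ⊗ a) ⊗ t ⊗ s)
      lem₁ = solve 6 (λ a r f i t s → (a :* r) :* (f :* (i :* t :* s)) := f :* r :* ((i :* a) :* t :* s)) refl
        where open +-*-Solver
      lem₂ : ∀ f r l i a → f ⊗ r ⊗ ((l ⊗ l ⊗ (i ⊗ (a ⊗ a))) ⊗ r) ≡ (i ⊗ f ⊗ (l ⊗ l)) ⊗ ((a ⊗ r) ⊗ (a ⊗ r))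
      lem₂ = solve 5 (λ f r l i a → f :* r :* ((l :* l :* (i :* (a :* a))) :* r) := (i :* f :* (l :* l)) :* ((a :* r) :* (a :* r))) refl
        where open +-*-Solver

-- Lower bounds and limits of the forms

sum-close : ∀ (f g : ℕ → ℚ) n {ε} → (∀ i → i < n → ∣ f i ⊖ g i ∣ ⩽ ε) → ∣ partialSum f n ⊖ partialSum g n ∣ ⩽ ι n ⊗ ε
sum-close f g n {ε} h = begin
  ∣ partialSum f n ⊖ partialSum g n ∣     ≡⟨ cong ∣_∣ (sum-⊖ f g n) ⟨
  ∣ partialSum (λ i → f i ⊖ g i) n ∣      ≤⟨ sum-∣∣ (λ i → f i ⊖ g i) n ⟩
  partialSum (λ i → ∣ f i ⊖ g i ∣) n      ≤⟨ sum-mono n h ⟩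
  partialSum (λ _ → ε) n                  ≡⟨ sum-const ε n ⟩
  ι n ⊗ ε                                 ∎
  where open ℚ.≤-Reasoning

form-close : ∀ (a b : ℕ → ℕ → ℚ) (c : ℕ → ℚ) D {g ε} → 0ℚ ⩽ g → (∀ j → j < D → ∣ c j ∣ ⩽ g) →
             (∀ i j → i < D → j < D → ∣ a i j ⊖ b i j ∣ ⩽ ε) →
             ∣ form a c D ⊖ form b c D ∣ ⩽ ι D ⊗ (ι D ⊗ ((g ⊗ g) ⊗ ε))
form-close a b c D {g} {ε} 0≤g c≤g h =
  sum-close (λ i → partialSum (λ j → (c i ⊗ c j) ⊗ a i j) D) (λ i → partialSum (λ j → (c i ⊗ c j) ⊗ b i j) D) D (λ i i<D →
    sum-close (λ j → (c i ⊗ c j) ⊗ a i j) (λ j → (c i ⊗ c j) ⊗ b i j) D (λ j j<D → term i j i<D j<D))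
  where
  open ℚ.≤-Reasoning
  term : ∀ i j → i < D → j < D → ∣ (c i ⊗ c j) ⊗ a i j ⊖ (c i ⊗ c j) ⊗ b i j ∣ ⩽ (g ⊗ g) ⊗ ε
  term i j i<D j<D = begin
    ∣ (c i ⊗ c j) ⊗ a i j ⊖ (c i ⊗ c j) ⊗ b i j ∣  ≡⟨ cong ∣_∣ (lem (c i ⊗ c j) (a i j) (b i j)) ⟩
    ∣ (c i ⊗ c j) ⊗ (a i j ⊖ b i j) ∣              ≡⟨ ℚ.∣p*q∣≡∣p∣*∣q∣ (c i ⊗ c j) (a i j ⊖ b i j) ⟩
    ∣ c i ⊗ c j ∣ ⊗ ∣ a i j ⊖ b i j ∣              ≡⟨ cong (_⊗ ∣ a i j ⊖ b i j ∣) (ℚ.∣p*q∣≡∣p∣*∣q∣ (c i) (c j)) ⟩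
    ∣ c i ∣ ⊗ ∣ c j ∣ ⊗ ∣ a i j ⊖ b i j ∣          ≤⟨ ⊗-mono (⊗-nonNeg (ℚ.0≤∣p∣ (c i)) (ℚ.0≤∣p∣ (c j)))
                                                      (ℚ.≤-trans (ℚ.0≤∣p∣ (a i j ⊖ b i j)) (h i j i<D j<D))
                                                      (⊗-mono (ℚ.0≤∣p∣ (c i)) 0≤g (c≤g i i<D) (c≤g j j<D)) (h i j i<D j<D) ⟩
    (g ⊗ g) ⊗ ε                                    ∎
    where
    lem : ∀ c a b → c ⊗ a ⊖ c ⊗ b ≡ c ⊗ (a ⊖ b)
    lem = solve 3 (λ c a b → c :* a :- c :* b := c :* (a :- b)) refl
      where open +-*-Solver

-- All nodes contribute squares, so one node where C is provably nonzero suffices. The bound δ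
-- depends on β but not on u or N, since u = 1/π_N moves with the stage.
form-apart : ∀ {β} s D G (c : ℕ → ℚ) → 0ℚ ⋖ β → (∀ j → IsInteger (c j)) → (∀ j → j < D → ∣ c j ∣ ⩽ ι G) →
             ∃[ j ] (j < D × c j ≢ 0ℚ) →
             ∃[ δ ] (0ℚ ⋖ δ × ∃[ N₀ ] (∀ u N → β ⩽ u → u ⩽ 1ℚ → N₀ ≤ N →
               δ ⩽ form (λ i j → moment u (s + 2 · (i + j)) N) c D))
form-apart {β} s D G c 0<β int c≤G nz =
  v ↑ s ⊗ (t ⊗ t) , ⊗-pos (↑-pos s 0<v) (⊗-pos 0<t 0<t) , suc n , bound
  where
  open ℚ.≤-Reasoning
  -- Far enough out that x ≤ 1/(n+1) satisfies x·D·G ≤ ½, as `poly-apart` requires.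
  n = 2 · (D · G)
  v = β ⊗ rec n
  t = ½ ⊗ (v ↑ 2) ↑ D
  0<v : 0ℚ ⋖ v
  0<v = ⊗-pos 0<β (rec-pos n)
  0<t : 0ℚ ⋖ t
  0<t = ⊗-pos (ℚ.positive⁻¹ ½) (↑-pos D (↑-pos 2 0<v))
  0≤v = ℚ.<⇒≤ 0<v
  rec≤1 : rec n ⩽ 1ℚ
  rec≤1 = subst₂ _⩽_ (ℚ.*-identityˡ (rec n)) (ι⊗rec n) (⊗-monoˡ (rec-nonNeg n) (1≤ι {suc n} (s≤s z≤n)))
  halve : rec n ⊗ (ι D ⊗ ι G) ⩽ ½
  halve = ⊗-cancelˡ-≤ {ι 2} (ι-pos 1) (begin
    ι 2 ⊗ (rec n ⊗ (ι D ⊗ ι G))  ≡⟨ cong (λ z → ι 2 ⊗ (rec n ⊗ z)) (ι-· D G) ⟨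
    ι 2 ⊗ (rec n ⊗ ι (D · G))    ≡⟨ lem (ι 2) (rec n) (ι (D · G)) ⟩
    (ι 2 ⊗ ι (D · G)) ⊗ rec n    ≡⟨ cong (_⊗ rec n) (ι-· 2 (D · G)) ⟨
    ι n ⊗ rec n                  ≤⟨ ⊗-monoˡ (rec-nonNeg n) (ι-mono-≤ (ℕ.n≤1+n n)) ⟩
    ι (suc n) ⊗ rec n            ≡⟨ ι⊗rec n ⟩
    (1ℚ ⊕ 1ℚ) ⊗ ½                ≡⟨ cong (λ z → (z ⊕ z) ⊗ ½) ι-1 ⟨
    (ι 1 ⊕ ι 1) ⊗ ½              ≡⟨ cong (_⊗ ½) (ι-+ 1 1) ⟨
    ι 2 ⊗ ½                      ∎)
    where
    lem : ∀ a b c → a ⊗ (b ⊗ c) ≡ (a ⊗ c) ⊗ b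
    lem = solve 3 (λ a b c → a :* (b :* c) := (a :* c) :* b) refl
      where open +-*-Solver
  bound : ∀ u N → β ⩽ u → u ⩽ 1ℚ → suc n ≤ N → v ↑ s ⊗ (t ⊗ t) ⩽ form (λ i j → moment u (s + 2 · (i + j)) N) c D
  bound u N β≤u u≤1 n<N = begin
    v ↑ s ⊗ (t ⊗ t)                        ≤⟨ ⊗-mono (↑-nonNeg s 0≤v) (⊗-nonNeg (ℚ.0≤∣p∣ (p n)) (ℚ.0≤∣p∣ (p n)))
                                                (↑-mono s 0≤v v≤w) (⊗-mono (ℚ.<⇒≤ 0<t) (ℚ.0≤∣p∣ (p n)) t≤p t≤p) ⟩
    w n ↑ s ⊗ (∣ p n ∣ ⊗ ∣ p n ∣)          ≡⟨ cong (w n ↑ s ⊗_) (square≡∣∣² (p n)) ⟨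
    w n ↑ s ⊗ (p n ⊗ p n)                  ≤⟨ term≤sum {λ n → w n ↑ s ⊗ (p n ⊗ p n)} nonNeg n<N ⟩
    partialSum (λ n → w n ↑ s ⊗ (p n ⊗ p n)) N ≡⟨ form-moment u s c D N ⟨
    form (λ i j → moment u (s + 2 · (i + j)) N) c D ∎
    where
    w = λ n → u ⊗ rec n
    p = λ n → poly c D (w n ↑ 2)
    0≤u : 0ℚ ⩽ u
    0≤u = ℚ.≤-trans (ℚ.<⇒≤ 0<β) β≤u
    0≤w : ∀ n → 0ℚ ⩽ w n
    0≤w n = ⊗-nonNeg 0≤u (rec-nonNeg n)
    nonNeg : ∀ n → 0ℚ ⩽ w n ↑ s ⊗ (p n ⊗ p n)
    nonNeg n = ⊗-nonNeg (↑-nonNeg s (0≤w n)) (subst (0ℚ ⩽_) (sym (square≡∣∣² (p n))) (⊗-nonNeg (ℚ.0≤∣p∣ (p n)) (ℚ.0≤∣p∣ (p n))))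
    v≤w : v ⩽ w n
    v≤w = ⊗-monoˡ (rec-nonNeg n) β≤u
    w≤rec : w n ⩽ rec n
    w≤rec = subst (w n ⩽_) (ℚ.*-identityˡ (rec n)) (⊗-monoˡ (rec-nonNeg n) u≤1)
    w≤1 : w n ⩽ 1ℚ
    w≤1 = ℚ.≤-trans w≤rec rec≤1
    w²≤rec : w n ↑ 2 ⩽ rec n
    w²≤rec = ℚ.≤-trans (⊗-monoʳ (0≤w n) (↑≤1 1 (0≤w n) w≤1)) (ℚ.≤-trans (ℚ.≤-reflexive (ℚ.*-identityʳ (w n))) w≤rec)
    t≤p : t ⩽ ∣ p n ∣
    t≤p = ℚ.≤-trans (⊗-monoʳ (ℚ.nonNegative⁻¹ ½) (↑-mono D (↑-nonNeg 2 0≤v) (↑-mono 2 0≤v v≤w)))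
      (poly-apart D (↑-nonNeg 2 (0≤w n)) (↑≤1 2 (0≤w n) w≤1) (ι-nonNeg G) int c≤G
        (ℚ.≤-trans (⊗-monoˡ (⊗-nonNeg (ι-nonNeg D) (ι-nonNeg G)) w²≤rec) halve) nz)

-- Convergence to ζ(s)/πˢ

inv-inverse : ∀ {p} → 0ℚ ⋖ p → p ⊗ inv p ≡ 1ℚ
inv-inverse {p} 0<p with p ℚ.≟ 0ℚ
... | yes p≡0 = contradiction (sym p≡0) (ℚ.<⇒≢ 0<p)
... | no  p≢0 = ℚ.*-inverseʳ p {{ℚ.≢-nonZero p≢0}}

inv-unique : ∀ {p r} → 0ℚ ⋖ p → p ⊗ r ≡ 1ℚ → inv p ≡ r
inv-unique 0<p eq = ⊗-cancelˡ-≡ 0<p (trans (inv-inverse 0<p) (sym eq))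

seq-^ : ∀ x s n → seq (x ^ s) n ≡ seq x n ↑ s
seq-^ x zero    n = refl
seq-^ x (suc s) n = cong (seq x n ⊗_) (seq-^ x s n)

ζ-term≡ : ∀ s n → ζ-term s n ≡ rec n ↑ s
ζ-term≡ s n with suc n ^ⁿ s | ℕ.m^n≢0 (suc n) s | ι-^ (suc n) s
... | suc t | _ | eq = trans (sym (rec≡ t)) (sym (rec-unique t (begin
  ι (suc t) ⊗ rec n ↑ s       ≡⟨ cong (_⊗ rec n ↑ s) eq ⟩
  ι (suc n) ↑ s ⊗ rec n ↑ s   ≡⟨ ↑-⊗ (ι (suc n)) (rec n) s ⟨
  (ι (suc n) ⊗ rec n) ↑ s     ≡⟨ cong (_↑ s) (ι⊗rec n) ⟩
  1ℚ ↑ s                      ≡⟨ 1↑ s ⟩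
  1ℚ                          ∎)))
  where open ≡-Reasoning

-- The identity is exact and not merely asymptotic: numerator and denominator of the quotient are
-- truncated at the same index N.
ζ/π^≡moment : ∀ s .{{_ : ℕ.NonTrivial s}} N → 0ℚ ⋖ seq π N → seq (ζ/π^ s) N ≡ moment (inv (seq π N)) s N
ζ/π^≡moment s N 0<p = begin
  partialSum (ζ-term s) N ⊗ inv (seq (π ^ s) N)
    ≡⟨ cong₂ _⊗_ (sum-cong N (ζ-term≡ s)) (cong inv (seq-^ π s N)) ⟩
  partialSum (λ n → rec n ↑ s) N ⊗ inv (p ↑ s)
    ≡⟨ cong (partialSum (λ n → rec n ↑ s) N ⊗_) (inv-unique (↑-pos s 0<p)
         (trans (sym (↑-⊗ p (inv p) s)) (trans (cong (_↑ s) (inv-inverse 0<p)) (1↑ s)))) ⟩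
  partialSum (λ n → rec n ↑ s) N ⊗ inv p ↑ s
    ≡⟨ sum-⊗ʳ (inv p ↑ s) (λ n → rec n ↑ s) N ⟨
  partialSum (λ n → rec n ↑ s ⊗ inv p ↑ s) N
    ≡⟨ sum-cong N (λ n → trans (ℚ.*-comm (rec n ↑ s) (inv p ↑ s)) (sym (↑-⊗ (inv p) (rec n) s))) ⟩
  moment (inv p) s N ∎
  where
  open ≡-Reasoning
  p = seq π N

π-term≥0 : ∀ n → 0ℚ ⩽ π-term n
π-term≥0 n = ⊖-nonNeg {+ 4 ℚ./ (1 + 4 · n)} {+ 4 ℚ./ (3 + 4 · n)} (ℚ.toℚᵘ-cancel-≤
  (ℚᵘ.≤-respˡ-≃ (ℚᵘ.≃-sym (ℚ.toℚᵘ-fromℚᵘ (ℚᵘ.mkℚᵘ (+ 4) (2 + 4 · n))))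
    (ℚᵘ.≤-respʳ-≃ (ℚᵘ.≃-sym (ℚ.toℚᵘ-fromℚᵘ (ℚᵘ.mkℚᵘ (+ 4) (4 · n))))
      (ℚᵘ.*≤* (ℤ.+≤+ (ℕ.*-monoʳ-≤ 4 (s≤s (ℕ.m≤n+m (4 · n) 2))))))))

3≤π : ∀ {N} → 4 ℕ.≤′ N → ι 3 ⩽ seq π N
-- Four grouped terms are the first eight of the Leibniz series, about 3.017; three groups still
-- fall short of 3.
3≤π ℕ.≤′-refl        = subst (_⩽ seq π 4) (sym (ι≡ 3)) (toWitness {a? = + 3 ℚ./ 1 ℚ.≤? seq π 4} tt)
3≤π (ℕ.≤′-step {N} h) = ℚ.≤-trans (3≤π h) (p≤p⊕q (π-term≥0 N))

eventually-all : ∀ {P : ℕ → ℕ → Set} n → (∀ i → i < n → ∃[ N₀ ] (∀ N → N₀ ≤ N → P i N)) →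
                 ∃[ N₀ ] (∀ N → N₀ ≤ N → ∀ i → i < n → P i N)
eventually-all zero h = 0 , λ _ _ _ ()
eventually-all {P} (suc n) h = N₁ ℕ.⊔ N₂ , both
  where
  ih = eventually-all {P} n (λ i i<n → h i (ℕ.m<n⇒m<1+n i<n))
  N₁ = proj₁ ih
  N₂ = proj₁ (h n ℕ.≤-refl)
  both : ∀ N → N₁ ℕ.⊔ N₂ ≤ N → ∀ i → i < suc n → P i N
  both N le i (s≤s i≤n) with ℕ.m≤n⇒m<n∨m≡n i≤n
  ... | inj₁ i<n  = proj₂ ih N (ℕ.m⊔n≤o⇒m≤o N₁ N₂ le) i i<n
  ... | inj₂ refl = proj₂ (h n ℕ.≤-refl) N (ℕ.m⊔n≤o⇒n≤o N₁ N₂ le)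

inv-π-bounds : ∀ {N} → 4 ≤ N → 0ℚ ⋖ seq π N × 0ℚ ⩽ inv (seq π N) × ι 3 ⊗ inv (seq π N) ⩽ 1ℚ × inv (seq π N) ⩽ 1ℚ
inv-π-bounds {N} 4≤N = 0<p , 0≤u , 3u≤1 , u≤1
  where
  p = seq π N
  u = inv p
  0<p : 0ℚ ⋖ p
  0<p = ℚ.<-≤-trans (ι-pos 2) (3≤π (ℕ.≤⇒≤′ 4≤N))
  0≤u : 0ℚ ⩽ u
  0≤u = ⊗-cancelˡ-≤ 0<p (subst₂ _⩽_ (sym (ℚ.*-zeroʳ p)) (sym (inv-inverse 0<p)) 0≤1)
  3u≤1 : ι 3 ⊗ u ⩽ 1ℚ
  3u≤1 = subst (ι 3 ⊗ u ⩽_) (inv-inverse 0<p) (⊗-monoˡ 0≤u (3≤π (ℕ.≤⇒≤′ 4≤N)))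
  u≤1 : u ⩽ 1ℚ
  u≤1 = ℚ.≤-trans (subst (_⩽ ι 3 ⊗ u) (ℚ.*-identityˡ u) (⊗-monoˡ 0≤u (1≤ι {3} (s≤s z≤n)))) 3u≤1

-- Supplies the β of `form-apart`. The Cauchy property with tolerance 1 bounds all late π_N from
-- above.
inv-π-lower : ∃[ β ] (0ℚ ⋖ β × ∃[ N₀ ] (∀ N → N₀ ≤ N → 4 ≤ N → β ⩽ inv (seq π N)))
inv-π-lower = inv B , 0<β , N₀ , bound
  where
  close = cauchy π 1ℚ 0<1
  N₀ = proj₁ close
  B = 1ℚ ⊕ ∣ seq π N₀ ∣
  0<B : 0ℚ ⋖ B
  0<B = ℚ.<-≤-trans 0<1 (p≤p⊕q (ℚ.0≤∣p∣ (seq π N₀)))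
  0<β : 0ℚ ⋖ inv B
  0<β = ℚ.≰⇒> (λ β≤0 → ℚ.<-irrefl refl (ℚ.<-≤-trans 0<1 (subst₂ _⩽_ (inv-inverse 0<B) (ℚ.*-zeroʳ B) (⊗-monoʳ (ℚ.<⇒≤ 0<B) β≤0))))
  bound : ∀ N → N₀ ≤ N → 4 ≤ N → inv B ⩽ inv (seq π N)
  bound N N₀≤N 4≤N = ⊗-cancelˡ-≤ 0<B (subst (_⩽ B ⊗ inv (seq π N)) (trans (inv-inverse 0<p) (sym (inv-inverse 0<B)))
    (⊗-monoˡ 0≤u p≤B))
    where
    0<p = proj₁ (inv-π-bounds 4≤N)
    0≤u = proj₁ (proj₂ (inv-π-bounds 4≤N))
    p≤B : seq π N ⩽ B
    p≤B = ℚ.≤-trans (∣p⊖q∣≤⇒p≤ (seq π N) (seq π N₀) (proj₂ close N N₀ N₀≤N ℕ.≤-refl))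
      (ℚ.≤-trans (ℚ.+-monoˡ-≤ 1ℚ (p≤∣p∣ (seq π N₀))) (ℚ.≤-reflexive (ℚ.+-comm ∣ seq π N₀ ∣ 1ℚ)))

-- Passage to the rational limits and the bound for the denominator

module Denominator (m ρ : ℕ) (ρ<2 : ρ < 2) (z : ℕ → ℚ)
  (convergent : ∀ e → e < suc (2 · m + ρ) → ζ/π^ (1 + 2 · (suc (2 · m + ρ) + e)) ≃ fromℚ (z e)) where

  a k M s f : ℕ
  a = 2 · m + ρ
  k = lowest m ρ
  M = suc m
  s = suc (2 · k)
  f = (suc k + 2 · m) !

  H : ℕ
  H = proj₁ (admissible ρ<2 m)

  -- The entries of the form at stage N, with limits `R`. The shift by ρ skips the lowest moment
  -- when a is odd, and the last entry, i = j = m, is the moment with e = a.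
  A : ℕ → ℕ → ℕ → ℚ
  A N i j = seq (ζ/π^ (1 + 2 · (suc a + (ρ + (i + j))))) N

  R : ℕ → ℕ → ℚ
  R i j = z (ρ + (i + j))

  G : ℕ
  G = coeffBound H M m

  coeffBound≤G : ∀ {j} → j < M → coeffBound H M j ≤ G
  coeffBound≤G (s≤s j≤m) = ℕ.*-monoʳ-≤ H (ℕ.^-monoʳ-≤ (3 · M) (ℕ.*-monoʳ-≤ 2 j≤m))

  A≡moment : ∀ N → 0ℚ ⋖ seq π N → ∀ c → form (A N) c M ≡ form (λ i j → moment (inv (seq π N)) (s + 2 · (i + j)) N) c M
  A≡moment N 0<p c = sum-cong M (λ i → sum-cong M (λ j → cong ((c i ⊗ c j) ⊗_)
    (trans (ζ/π^≡moment (1 + 2 · (suc a + (ρ + (i + j)))) N 0<p) (cong (λ e → moment (inv (seq π N)) e N) (exponent m ρ i j)))))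
    where
    exponent : ∀ m ρ i j → 1 + 2 · (suc (2 · m + ρ) + (ρ + (i + j))) ≡ suc (2 · suc (2 · m + 2 · ρ)) + 2 · (i + j)
    exponent = solve-∀

  ρ+i+j<1+a : ∀ {i j} → i < M → j < M → ρ + (i + j) < suc a
  ρ+i+j<1+a {i} {j} (s≤s i≤m) (s≤s j≤m) = s≤s (ℕ.≤-trans (ℕ.+-monoʳ-≤ ρ (ℕ.+-mono-≤ i≤m j≤m)) (ℕ.≤-reflexive (eq m ρ)))
    where
    eq : ∀ m ρ → ρ + (m + m) ≡ 2 · m + ρ
    eq = solve-∀

  form-converges : ∀ η → 0ℚ ⋖ η → ∃[ N₀ ] (∀ N → N₀ ≤ N → ∀ c → (∀ j → ∣ c j ∣ ⩽ ι (coeffBound H M j)) →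
                   ∣ form (A N) c M ⊖ form R c M ∣ ⩽ η)
  form-converges η 0<η = proj₁ uniform , λ N N₀≤N c c≤ → begin
    ∣ form (A N) c M ⊖ form R c M ∣              ≤⟨ form-close (A N) R c M (ι-nonNeg G)
                                                      (λ j j<M → ℚ.≤-trans (c≤ j) (ι-mono-≤ (coeffBound≤G j<M)))
                                                      (λ i j i<M j<M → proj₂ uniform N N₀≤N (ρ + (i + j)) (ρ+i+j<1+a i<M j<M)) ⟩
    ι M ⊗ (ι M ⊗ ((ι G ⊗ ι G) ⊗ (η ⊗ rec κ)))    ≡⟨ lem (ι M) (ι G) η (rec κ) ⟩
    η ⊗ (((ι M ⊗ ι M) ⊗ (ι G ⊗ ι G)) ⊗ rec κ)    ≡⟨ cong (λ x → η ⊗ (x ⊗ rec κ)) (trans (ι-· (M · M) (G · G)) (cong₂ _⊗_ (ι-· M M) (ι-· G G))) ⟨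
    η ⊗ (ι κ ⊗ rec κ)                            ≤⟨ ⊗-monoʳ (ℚ.<⇒≤ 0<η) (⊗-monoˡ (rec-nonNeg κ) (ι-mono-≤ (ℕ.n≤1+n κ))) ⟩
    η ⊗ (ι (suc κ) ⊗ rec κ)                      ≡⟨ trans (cong (η ⊗_) (ι⊗rec κ)) (ℚ.*-identityʳ η) ⟩
    η                                            ∎
    where
    open ℚ.≤-Reasoning
    -- There are M² entries with |c_i c_j| ≤ G², so it suffices to know each entry to within
    -- η/(κ+1).
    κ : ℕ
    κ = (M · M) · (G · G)
    uniform : ∃[ N₀ ] (∀ N → N₀ ≤ N → ∀ e → e < suc a → ∣ seq (ζ/π^ (1 + 2 · (suc a + e))) N ⊖ z e ∣ ⩽ η ⊗ rec κ)
    uniform = eventually-all (suc a) (λ e e≤a → convergent e e≤a (η ⊗ rec κ) (⊗-pos 0<η (rec-pos κ)))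
    lem : ∀ m g e r → m ⊗ (m ⊗ ((g ⊗ g) ⊗ (e ⊗ r))) ≡ e ⊗ (((m ⊗ m) ⊗ (g ⊗ g)) ⊗ r)
    lem = solve 4 (λ m g e r → m :* (m :* ((g :* g) :* (e :* r))) := e :* (((m :* m) :* (g :* g)) :* r)) refl
      where open +-*-Solver

  -- At a late stage the form is at least δ, uniformly, and differs from its limit by at most δ/2;
  -- so δ/2 survives.
  form-R-positive : ∀ c → (∀ j → IsInteger (c j)) → (∀ j → ∣ c j ∣ ⩽ ι (coeffBound H M j)) →
                    ∃[ j ] (j < M × c j ≢ 0ℚ) → 0ℚ ⋖ form R c M
  form-R-positive c int c≤ nz = ℚ.<-≤-trans (⊗-pos 0<½ 0<δ) (⊕-cancelʳ-≤ {½ ⊗ δ} {form R c M} {½ ⊗ δ} (begin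
    ½ ⊗ δ ⊕ ½ ⊗ δ            ≡⟨ lem δ ⟩
    δ                        ≤⟨ δ≤ u N β≤u u≤1 N₁≤N ⟩
    form (λ i j → moment u (s + 2 · (i + j)) N) c M ≡⟨ A≡moment N (proj₁ π-bounds) c ⟨
    form (A N) c M           ≤⟨ ∣p⊖q∣≤⇒p≤ (form (A N) c M) (form R c M) (proj₂ limit N N₂≤N c c≤) ⟩
    form R c M ⊕ ½ ⊗ δ       ∎))
    where
    open ℚ.≤-Reasoning
    0<½ : 0ℚ ⋖ ½
    0<½ = ℚ.positive⁻¹ ½
    β = proj₁ inv-π-lower
    apart = form-apart s M G c (proj₁ (proj₂ inv-π-lower)) int (λ j j<M → ℚ.≤-trans (c≤ j) (ι-mono-≤ (coeffBound≤G j<M))) nz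
    δ = proj₁ apart
    0<δ : 0ℚ ⋖ δ
    0<δ = proj₁ (proj₂ apart)
    limit = form-converges (½ ⊗ δ) (⊗-pos 0<½ 0<δ)
    N₀ N₁ N₂ N : ℕ
    N₀ = proj₁ (proj₂ (proj₂ inv-π-lower))
    N₁ = proj₁ (proj₂ (proj₂ apart))
    N₂ = proj₁ limit
    N = (N₀ + N₁) + (N₂ + 4)
    N₁≤N : N₁ ≤ N
    N₁≤N = ℕ.≤-trans (ℕ.m≤n+m N₁ N₀) (ℕ.m≤m+n (N₀ + N₁) (N₂ + 4))
    N₂≤N : N₂ ≤ N
    N₂≤N = ℕ.≤-trans (ℕ.m≤m+n N₂ 4) (ℕ.m≤n+m (N₂ + 4) (N₀ + N₁))
    4≤N : 4 ≤ N
    4≤N = ℕ.≤-trans (ℕ.m≤n+m 4 N₂) (ℕ.m≤n+m (N₂ + 4) (N₀ + N₁))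
    u = inv (seq π N)
    π-bounds = inv-π-bounds 4≤N
    u≤1 = proj₂ (proj₂ (proj₂ π-bounds))
    β≤u : β ⩽ u
    β≤u = proj₂ (proj₂ (proj₂ inv-π-lower)) N (ℕ.≤-trans (ℕ.m≤m+n N₀ N₁) (ℕ.m≤m+n (N₀ + N₁) (N₂ + 4))) 4≤N
    δ≤ = proj₂ (proj₂ (proj₂ apart))
    lem : ∀ d → ½ ⊗ d ⊕ ½ ⊗ d ≡ d
    lem = solve 1 (λ d → con ½ :* d :+ con ½ :* d := d) refl
      where open +-*-Solver

  -- The polynomial must come from a finite stage N, since the box principle needs decidable comparisons;
  -- N is chosen so late that no form with admissible coefficients moves by more than η afterwards.
  small-form : ∃[ c ] (∀ j → IsInteger (c j)) × 0ℚ ⋖ form R c M × ι f ⊗ form R c M ⋖ 1ℚ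
  small-form = c , integral , form-R-positive c integral bounded nonzero , upper
    where
    N : ℕ
    -- Then fη ≤ ½; together with fF ≤ 1/3 at stage N this keeps f times the limit form below 1.
    η = ½ ⊗ rec f
    limit = form-converges η (⊗-pos (ℚ.positive⁻¹ ½) (rec-pos f))
    N = proj₁ limit + 4
    π-bounds = inv-π-bounds {N} (ℕ.m≤n+m 4 (proj₁ limit))
    u = inv (seq π N)
    adm = proj₂ (admissible ρ<2 m)
    open Estimate m k H {u} (proj₁ (proj₂ π-bounds)) (proj₁ (proj₂ (proj₂ π-bounds)))
      using (Small; module Small; small-polynomial; weight; sum-weight≤)
    found = small-polynomial (proj₂ adm)
    c = proj₁ found
    open Small (proj₂ found)
    F = form (A N) c M
    F≡ : F ≡ partialSum (weight c) N
    F≡ = trans (A≡moment N (proj₁ π-bounds) c) (form-moment u s c M N)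
    3fF≤1 : ι 3 ⊗ (ι f ⊗ F) ⩽ 1ℚ
    3fF≤1 = subst (λ x → ι 3 ⊗ (ι f ⊗ x) ⩽ 1ℚ) (sym F≡) (sum-weight≤ (s≤s z≤n) {c} (proj₂ found) N (proj₁ adm))
    fη≤½ : ι f ⊗ η ⩽ ½
    fη≤½ = ℚ.≤-trans (ℚ.≤-reflexive (lem (ι f) (rec f)))
      (ℚ.≤-trans (⊗-monoʳ (ℚ.nonNegative⁻¹ ½) (ℚ.≤-trans (⊗-monoˡ (rec-nonNeg f) (ι-mono-≤ (ℕ.n≤1+n f))) (ℚ.≤-reflexive (ι⊗rec f))))
        (ℚ.≤-reflexive (ℚ.*-identityʳ ½)))
      where
      lem : ∀ f r → f ⊗ (½ ⊗ r) ≡ ½ ⊗ (f ⊗ r)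
      lem = solve 2 (λ f r → f :* (con ½ :* r) := con ½ :* (f :* r)) refl
        where open +-*-Solver
    fF≤⅓ : ι f ⊗ F ⩽ + 1 ℚ./ 3
    fF≤⅓ = ⊗-cancelˡ-≤ (ι-pos 2) (ℚ.≤-trans 3fF≤1 (ℚ.≤-reflexive (trans (sym (ι⊗rec 2)) (cong (ι 3 ⊗_) (rec≡ 2)))))
    upper : ι f ⊗ form R c M ⋖ 1ℚ
    upper = ℚ.≤-<-trans (begin
      ι f ⊗ form R c M        ≤⟨ ⊗-monoʳ (ι-nonNeg f) (∣p⊖q∣≤⇒q≤ F (form R c M) (proj₂ limit N (ℕ.m≤m+n (proj₁ limit) 4) c bounded)) ⟩
      ι f ⊗ (F ⊕ η)           ≡⟨ ℚ.*-distribˡ-+ (ι f) F η ⟩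
      ι f ⊗ F ⊕ ι f ⊗ η       ≤⟨ ℚ.+-mono-≤ fF≤⅓ fη≤½ ⟩
      + 1 ℚ./ 3 ⊕ ½           ∎) (toWitness {a? = + 1 ℚ./ 3 ⊕ ½ ℚ.<? 1ℚ} tt)
      where open ℚ.≤-Reasoning

  -- If q cleared all denominators, q times the form would be a positive integer, hence at least 1.
  -- But f times the form is less than 1, so q < f is impossible.
  denominator≥ : ∀ q → 0 < q → (∀ e → e < suc a → IsInteger (ι q ⊗ z e)) → f ≤ q
  denominator≥ (suc q) _ int = ℕ.≮⇒≥ (contradict small-form)
    where
    contradict : ∃[ c ] (∀ j → IsInteger (c j)) × 0ℚ ⋖ form R c M × ι f ⊗ form R c M ⋖ 1ℚ → ¬ suc q < f
    contradict (c , integral , 0<R , fR<1) q<f = ℚ.<-irrefl refl (ℚ.≤-<-trans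
      (IsInteger-pos qR-integer (⊗-pos (ι-pos q) 0<R))
      (ℚ.≤-<-trans (⊗-monoˡ (ℚ.<⇒≤ 0<R) (ι-mono-≤ (ℕ.<⇒≤ q<f))) fR<1))
      where
      qR-integer : IsInteger (ι (suc q) ⊗ form R c M)
      qR-integer = subst IsInteger (form-⊗ (ι (suc q)) R c M)
        (IsInteger-sum M (λ i i<M → IsInteger-sum M (λ j j<M →
          IsInteger-⊗ (IsInteger-⊗ (integral i) (integral j)) (int (ρ + (i + j)) (ρ+i+j<1+a i<M j<M)))))

-- Parity of a, and translation between `Fin` and bounded indices

halve : ∀ a → ∃[ m ] ∃[ ρ ] (ρ < 2 × a ≡ 2 · m + ρ)
halve zero = 0 , 0 , s≤s z≤n , refl
halve (suc zero) = 0 , 1 , s≤s (s≤s z≤n) , refl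
halve (suc (suc a)) with halve a
... | m , ρ , ρ<2 , refl = suc m , ρ , ρ<2 , eq m ρ
  where
  eq : ∀ m ρ → 2 + (2 · m + ρ) ≡ 2 · suc m + ρ
  eq = solve-∀

-- Makes the limits a total sequence; the default 0 lies outside the range of moments in which
-- convergence is assumed.
extend : ∀ {n} → (∀ e → e < n → ℚ) → ℕ → ℚ
extend {n} r e with e ℕ.<? n
... | yes e<n = r e e<n
... | no  _   = 0ℚ

extend≡ : ∀ {n} (r : ∀ e → e < n → ℚ) {e} (e<n : e < n) → extend r e ≡ r e e<n
extend≡ {n} r {e} e<n with e ℕ.<? n
... | yes p   = cong (r e) (ℕ.<-irrelevant p e<n)
... | no  e≮n = contradiction e<n e≮n

mainTheorem3 : (a : ℕ) →
    (rational : (i : Fin (suc a)) → IsRational (ζ/π^ (1 + 2 · (suc a + toℕ i)))) →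
    (q : ℕ) → IsCommonDenominator (λ i → proj₁ (rational i)) q →
    (2 · a + 2) ! ≤ q
mainTheorem3 a rational q isCD = bound (halve a) rational isCD
  where
  open IsCommonDenominator
  -- Quantified over a anew, so that a = 2m + ρ can be substituted in the types of `rational` and
  -- `isCD`, which depend on a.
  bound : ∀ {a} → ∃[ m ] ∃[ ρ ] (ρ < 2 × a ≡ 2 · m + ρ) →
    (rational : (i : Fin (suc a)) → IsRational (ζ/π^ (1 + 2 · (suc a + toℕ i)))) →
    IsCommonDenominator (λ i → proj₁ (rational i)) q → (2 · a + 2) ! ≤ q
  bound {a} (m , ρ , ρ<2 , refl) rational isCD = subst (λ n → n ! ≤ q) (eq m ρ)
    (Denominator.denominator≥ m ρ ρ<2 (extend r) convergent q (positive isCD) integer)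
    where
    eq : ∀ m ρ → suc (suc (2 · m + 2 · ρ)) + 2 · m ≡ 2 · (2 · m + ρ) + 2
    eq = solve-∀
    r : ∀ e → e < suc a → ℚ
    r e e≤a = proj₁ (rational (Fin.fromℕ< e≤a))
    convergent : ∀ e → e < suc a → ζ/π^ (1 + 2 · (suc a + e)) ≃ fromℚ (extend r e)
    convergent e e≤a = subst₂ (λ t p → ζ/π^ (1 + 2 · (suc a + t)) ≃ fromℚ p)
      (Fin.toℕ-fromℕ< e≤a) (sym (extend≡ r e≤a)) (proj₂ (rational (Fin.fromℕ< e≤a)))
    integer : ∀ e → e < suc a → IsInteger (ι q ⊗ extend r e)
    integer e e≤a = subst₂ (λ t p → IsInteger (t ⊗ p)) (sym (ι≡ q)) (sym (extend≡ r e≤a))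
      (clears isCD (Fin.fromℕ< e≤a))
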